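{- Let $F(x,y)=\sum_{n\ge1}\sum_{\sigma\in S_n(T_1)}x^ny^{asc(\sigma)}$ and $E(x,y)=\sum_{n\ge1}\sum_{\sigma\in S_n(T_1),\,\sigma(n)=n}x^ny^{asc(\sigma)}$. Then $$F(x,y)=\frac{E(x,y)\bigl(1-yE(x,y)\bigr)}{1-E(x,y)-yE(x,y)}.$$
   Context: A permutation $\sigma$ avoids $\tau$ if no subsequence of $\sigma$ has the same relative order as $\tau$. $T_1=\{3214,3241,4213,4231\}$ and $S_n(T_1)$ is the set of permutations in $S_n$ avoiding all four patterns. $asc(\sigma)$ is the number of positions $i$ with $\sigma(i)<\sigma(i+1)$. Generating functions are formal power series. -}

module Defs where

open import Data.Nat using (ℕ; zero; suc; _<ᵇ_; _≡ᵇ_; _∸_)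
open import Data.Bool using (Bool; true; false; _∧_; _∨_; not; if_then_else_)
open import Data.List using (List; []; _∷_; [_]; map; concatMap; _++_; length; upTo; zip)
open import Data.List.Base using (last)
open import Data.Maybe using (Maybe; just; nothing)
open import Data.Integer using (ℤ; +_; _+_; _-_; _*_)
open import Data.Product using (_×_; _,_)

_==_ : ℕ → ℕ → Bool
_==_ = _≡ᵇ_

_⇔ᵇ_ : Bool → Bool → Bool
true  ⇔ᵇ b = b
false ⇔ᵇ b = not b

filterᵇ : {A : Set} → (A → Bool) → List A → List A
filterᵇ p []       = []
filterᵇ p (a ∷ as) = if p a then a ∷ filterᵇ p as else filterᵇ p as

anyᵇ : {A : Set} → (A → Bool) → List A → Bool
anyᵇ p []       = false
anyᵇ p (a ∷ as) = p a ∨ anyᵇ p as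

allᵇ : {A : Set} → (A → Bool) → List A → Bool
allᵇ p []       = true
allᵇ p (a ∷ as) = p a ∧ allᵇ p as

-- Permutations of length n, represented as one-line notation lists
-- [σ(1), …, σ(n)] with values in {0, …, n-1} (0-based values; relative
-- order, ascents and the condition σ(n) = n are unaffected by the shift).

words : ℕ → ℕ → List (List ℕ)
words zero    m = [ [] ]
words (suc n) m = concatMap (λ a → map (a ∷_) (words n m)) (upTo m)

notIn : ℕ → List ℕ → Bool
notIn a []       = true
notIn a (b ∷ bs) = not (a == b) ∧ notIn a bs

distinct : List ℕ → Bool
distinct []       = true
distinct (a ∷ as) = notIn a as ∧ distinct as

Sn : ℕ → List (List ℕ)
Sn n = filterᵇ distinct (words n n)

subseqs : ℕ → List ℕ → List (List ℕ)
subseqs zero    _        = [ [] ]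
subseqs (suc k) []       = []
subseqs (suc k) (x ∷ xs) = map (x ∷_) (subseqs k xs) ++ subseqs (suc k) xs

sameOrderWith : ℕ × ℕ → List (ℕ × ℕ) → Bool
sameOrderWith p [] = true
sameOrderWith (a , c) ((b , d) ∷ ps) =
  (((a <ᵇ b) ⇔ᵇ (c <ᵇ d)) ∧ ((b <ᵇ a) ⇔ᵇ (d <ᵇ c)))
  ∧ sameOrderWith (a , c) ps

sameOrderPairs : List (ℕ × ℕ) → Bool
sameOrderPairs []       = true
sameOrderPairs (p ∷ ps) = sameOrderWith p ps ∧ sameOrderPairs ps

orderIso : List ℕ → List ℕ → Bool
orderIso s t = (length s == length t) ∧ sameOrderPairs (zip s t)

contains : List ℕ → List ℕ → Bool
contains σ τ = anyᵇ (λ s → orderIso s τ) (subseqs (length τ) σ)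

avoids : List ℕ → List ℕ → Bool
avoids σ τ = not (contains σ τ)

T₁ : List (List ℕ)
T₁ = (3 ∷ 2 ∷ 1 ∷ 4 ∷ []) ∷ (3 ∷ 2 ∷ 4 ∷ 1 ∷ []) ∷ (4 ∷ 2 ∷ 1 ∷ 3 ∷ [])
   ∷ (4 ∷ 2 ∷ 3 ∷ 1 ∷ []) ∷ []

avoidsT₁ : List ℕ → Bool
avoidsT₁ σ = allᵇ (avoids σ) T₁

SnT₁ : ℕ → List (List ℕ)
SnT₁ n = filterᵇ avoidsT₁ (Sn n)

asc : List ℕ → ℕ
asc (a ∷ b ∷ l) = (if a <ᵇ b then 1 else 0) Data.Nat.+ asc (b ∷ l)
asc _           = 0

-- σ(n) = n  (0-based: last entry equals n-1)
lastIsMax : ℕ → List ℕ → Bool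
lastIsMax n σ with last σ
... | just a  = a == (n ∸ 1)
... | nothing = false

-- Formal power series in x, y with integer coefficients:
-- a series is its coefficient function, (n , k) ↦ [x^n y^k].

Series : Set
Series = ℕ → ℕ → ℤ

sumℤ : List ℤ → ℤ
sumℤ []       = + 0
sumℤ (a ∷ as) = a + sumℤ as

sumTo : ℕ → (ℕ → ℤ) → ℤ
sumTo n f = sumℤ (map f (upTo (suc n)))

oneS : Series
oneS zero zero = + 1
oneS _    _    = + 0

_⊕_ : Series → Series → Series
(f ⊕ g) n k = f n k + g n k

_⊖_ : Series → Series → Series
(f ⊖ g) n k = f n k - g n k

_⊛_ : Series → Series → Series
(f ⊛ g) n k = sumTo n (λ i → sumTo k (λ j → f i j * g (n ∸ i) (k ∸ j)))

yS : Series
yS zero (suc zero) = + 1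
yS _    _          = + 0

count : {A : Set} → (A → Bool) → List A → ℕ
count p xs = length (filterᵇ p xs)

F : Series
F zero    k = + 0
F (suc n) k = + count (λ σ → asc σ == k) (SnT₁ (suc n))

E : Series
E zero    k = + 0
E (suc n) k = + count (λ σ → lastIsMax (suc n) σ ∧ (asc σ == k)) (SnT₁ (suc n))

module Submission where

{- An entry b of σ spoils avoidance of T₁ iff a larger entry precedes it and both a smaller and a larger entry
   follow it. So σ avoids T₁ iff every entry that is not a left-to-right maximum is the least or the greatest among
   the entries from it on. Before n is placed, only "least" is possible, and σ becomes a lattice path: the height
   counts the unused values below the current maximum, and a new maximum raises it. Let P_s be the series of the
   prefixes that end with n and leave s values unused. Cutting such a path at its last departures from the heights
   0, 1, …, s - 1 gives P_s = E^(s+1), and the remaining s values contribute (1 + y)^(s-1) for s ≥ 1. Summing over s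
   yields F = E + E (F + y F - y E). -}

-- No power of E and no sum over s is formed. A path carries a weight that depends only on its final
-- height, the number of values left after n: `oneS` keeps the paths that end at height 0 and gives
-- E, `terminal` gives F. One cut, at the last departure from height 0, leaves a path of the same
-- kind whose weights are moved down by one. The moved `terminal` is (1 + y) times `terminal`,
-- except at height 0, where a single leftover entry has no choice and the factor is 1; the
-- correction is the term - y E. Since path series are linear in the weights, the remainder sums to
-- F + y F - y E. Only the least value is possible before n because n itself still follows and is
-- larger.

open import Defs
open import Data.Bool using (Bool; true; false; T; not; _∧_; if_then_else_)
open import Data.Bool.Properties using (∧-zeroʳ; T-∧; T-∨; T-≡)
open import Data.Empty using (⊥; ⊥-elim)
open import Data.Integer using (ℤ; +_; -_; _+_; _-_; _*_)
open import Data.Integer.Properties using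
  ( +-identityʳ; +-identityˡ; +-comm; +-assoc; pos-+; neg-distrib-+; neg-distribˡ-*
  ; *-zeroˡ; *-identityˡ; *-comm; *-distribʳ-+)
open import Data.Integer.Tactic.RingSolver using (solve-∀)
open import Data.List using
  (List; []; _∷_; [_]; map; concatMap; _++_; length; upTo; initLast; _∷ʳ′_)
open import Data.List.Membership.Propositional using (_∈_)
open import Data.List.Membership.Propositional.Properties using
  (∈-++⁺ˡ; ∈-++⁺ʳ; ∈-++⁻; ∈-map⁺; ∈-map⁻; ∈-concat⁻′)
open import Data.List.Properties using
  ( map-applyUpTo; map-upTo; map-∘; concatMap-cong; concatMap-map; length-upTo; length-++-comm
  ; ++-assoc; ++-identityʳ; upTo-∷ʳ)
open import Data.List.Relation.Binary.Permutation.Propositional using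
  (_↭_; ↭⇒↭ₛ; ↭-refl; ↭-sym; ↭-trans; prep; swap)
open import Data.List.Relation.Binary.Permutation.Propositional.Properties using
  (All-resp-↭; ∈-resp-↭; ↭-length)
import Data.List.Relation.Binary.Permutation.Setoid.Properties as ↭ₛ
open import Data.List.Relation.Binary.Sublist.Propositional using
  (_⊆_; []; _∷_; _∷ʳ_; minimum; from∈; lookup)
open import Data.List.Relation.Unary.All as All using (All; []; _∷_)
import Data.List.Relation.Unary.All.Properties as All
open import Data.List.Relation.Unary.AllPairs as AllPairs using (AllPairs; []; _∷_)
import Data.List.Relation.Unary.AllPairs.Properties as AllPairs
open import Data.List.Relation.Unary.Any using (here; there)
open import Data.List.Relation.Unary.Unique.Propositional using (Unique)
open import Data.Nat as ℕ using (ℕ; zero; suc; _∸_; _≤_; _<_; _<ᵇ_; z≤n; s≤s)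
import Data.Nat.Properties as ℕ
open import Data.Product using (_×_; _,_; proj₁; proj₂; ∃; map₂)
open import Data.Sum using (_⊎_; inj₁; inj₂)
open import Data.Unit using (tt)
open import Function using (_∘_; id; Equivalence)
open import Relation.Binary.Definitions using (tri<; tri≈; tri>)
open import Relation.Binary.PropositionalEquality hiding ([_])
open import Relation.Nullary using (¬_; contradiction)

open Equivalence using (to; from)
open ≡-Reasoning

-- Formal power series

infix 4 _≐_
_≐_ : Series → Series → Set
f ≐ g = ∀ n k → f n k ≡ g n k

-- Unlike sumTo, this recursion does not unfold at a variable bound, so the summand can be inferred.
∑ : ℕ → (ℕ → ℤ) → ℤ
∑ zero    f = f 0
∑ (suc n) f = f 0 + ∑ n (f ∘ suc)

sumTo≡∑ : ∀ n f → sumTo n f ≡ ∑ n f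
sumTo≡∑ zero    f = +-identityʳ (f 0)
sumTo≡∑ (suc n) f = cong (_+_ (f 0)) (trans
  (cong sumℤ (trans (map-applyUpTo suc f (suc n)) (sym (map-upTo (f ∘ suc) (suc n)))))
  (sumTo≡∑ n (f ∘ suc)))

-- The bound is handed to the summands because reversing an index twice, `m ∸ (m ∸ n)`, gives back
-- `n` only within range.
∑-cong : ∀ n {f g} → (∀ i → i ≤ n → f i ≡ g i) → ∑ n f ≡ ∑ n g
∑-cong zero    f≗g = f≗g 0 z≤n
∑-cong (suc n) f≗g = cong₂ _+_ (f≗g 0 z≤n) (∑-cong n λ i i≤n → f≗g (suc i) (s≤s i≤n))

∑-zero : ∀ n {f} → (∀ i → f i ≡ + 0) → ∑ n f ≡ + 0
∑-zero zero    f≗0 = f≗0 0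
∑-zero (suc n) f≗0 = cong₂ _+_ (f≗0 0) (∑-zero n (f≗0 ∘ suc))

∑-+ : ∀ n f g → ∑ n (λ i → f i + g i) ≡ ∑ n f + ∑ n g
∑-+ zero    f g = refl
∑-+ (suc n) f g = trans (cong (_+_ (f 0 + g 0)) (∑-+ n (f ∘ suc) (g ∘ suc)))
                        (interchange (f 0) (g 0) (∑ n (f ∘ suc)) (∑ n (g ∘ suc)))
  where
  interchange : ∀ a b c d → (a + b) + (c + d) ≡ (a + c) + (b + d)
  interchange = solve-∀

∑-neg : ∀ n f → ∑ n (λ i → - f i) ≡ - ∑ n f
∑-neg zero    f = refl
∑-neg (suc n) f = trans (cong (_+_ (- f 0)) (∑-neg n (f ∘ suc))) (sym (neg-distrib-+ (f 0) _))

∑-snoc : ∀ n f → ∑ (suc n) f ≡ ∑ n f + f (suc n)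
∑-snoc zero    f = refl
∑-snoc (suc n) f = trans (cong (_+_ (f 0)) (∑-snoc n (f ∘ suc))) (sym (+-assoc (f 0) _ _))

∑-reverse : ∀ n f → ∑ n (λ i → f (n ∸ i)) ≡ ∑ n f
∑-reverse zero    f = refl
∑-reverse (suc n) f = begin
  ∑ (suc n) (λ i → f (suc n ∸ i))                ≡⟨ ∑-snoc n (λ i → f (suc n ∸ i)) ⟩
  ∑ n (λ i → f (suc n ∸ i)) + f (n ∸ n)          ≡⟨ cong₂ _+_ (∑-cong n λ i i≤n → cong f (ℕ.+-∸-assoc 1 i≤n))
                                                              (cong f (ℕ.n∸n≡0 n)) ⟩
  ∑ n (λ i → f (suc (n ∸ i))) + f 0              ≡⟨ cong (_+ f 0) (∑-reverse n (f ∘ suc)) ⟩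
  ∑ n (f ∘ suc) + f 0                            ≡⟨ +-comm _ (f 0) ⟩
  ∑ (suc n) f                                    ∎

⊛-∑ : ∀ f g n k → (f ⊛ g) n k ≡ ∑ n (λ i → ∑ k (λ j → f i j * g (n ∸ i) (k ∸ j)))
⊛-∑ f g n k = trans (sumTo≡∑ n _) (∑-cong n λ i _ → sumTo≡∑ k _)

⊛-cong : ∀ {f f′ g g′} → f ≐ f′ → g ≐ g′ → f ⊛ g ≐ f′ ⊛ g′
⊛-cong {f} {f′} {g} {g′} f≐f′ g≐g′ n k = begin
  (f ⊛ g) n k      ≡⟨ ⊛-∑ f g n k ⟩
  _                ≡⟨ (∑-cong n λ i _ → ∑-cong k λ j _ → cong₂ _*_ (f≐f′ i j) (g≐g′ (n ∸ i) (k ∸ j))) ⟩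
  _                ≡⟨ ⊛-∑ f′ g′ n k ⟨
  (f′ ⊛ g′) n k    ∎

⊛-comm : ∀ f g → f ⊛ g ≐ g ⊛ f
⊛-comm f g n k = begin
  (f ⊛ g) n k
    ≡⟨ ⊛-∑ f g n k ⟩
  ∑ n (λ i → ∑ k (λ j → f i j * g (n ∸ i) (k ∸ j)))
    ≡⟨ ∑-reverse n (λ i → ∑ k (λ j → f i j * g (n ∸ i) (k ∸ j))) ⟨
  ∑ n (λ i → ∑ k (λ j → f (n ∸ i) j * g (n ∸ (n ∸ i)) (k ∸ j)))
    ≡⟨ (∑-cong n λ i _ → sym (∑-reverse k (λ j → f (n ∸ i) j * g (n ∸ (n ∸ i)) (k ∸ j)))) ⟩
  ∑ n (λ i → ∑ k (λ j → f (n ∸ i) (k ∸ j) * g (n ∸ (n ∸ i)) (k ∸ (k ∸ j))))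
    ≡⟨ (∑-cong n λ i i≤n → ∑-cong k λ j j≤k →
         trans (*-comm (f (n ∸ i) (k ∸ j)) (g (n ∸ (n ∸ i)) (k ∸ (k ∸ j))))
               (cong (_* f (n ∸ i) (k ∸ j)) (cong₂ g (ℕ.m∸[m∸n]≡n i≤n) (ℕ.m∸[m∸n]≡n j≤k)))) ⟩
  ∑ n (λ i → ∑ k (λ j → g i j * f (n ∸ i) (k ∸ j)))
    ≡⟨ ⊛-∑ g f n k ⟨
  (g ⊛ f) n k
    ∎

⊛-distribʳ-⊕ : ∀ h f g → (f ⊕ g) ⊛ h ≐ (f ⊛ h) ⊕ (g ⊛ h)
⊛-distribʳ-⊕ h f g n k = begin
  ((f ⊕ g) ⊛ h) n k
    ≡⟨ ⊛-∑ (f ⊕ g) h n k ⟩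
  ∑ n (λ i → ∑ k (λ j → (f i j + g i j) * h (n ∸ i) (k ∸ j)))
    ≡⟨ (∑-cong n λ i _ → trans
         (∑-cong k λ j _ → *-distribʳ-+ (h (n ∸ i) (k ∸ j)) (f i j) (g i j))
         (∑-+ k (λ j → f i j * h (n ∸ i) (k ∸ j)) (λ j → g i j * h (n ∸ i) (k ∸ j)))) ⟩
  ∑ n (λ i → ∑ k (λ j → f i j * h (n ∸ i) (k ∸ j)) + ∑ k (λ j → g i j * h (n ∸ i) (k ∸ j)))
    ≡⟨ ∑-+ n _ _ ⟩
  ∑ n (λ i → ∑ k (λ j → f i j * h (n ∸ i) (k ∸ j))) + ∑ n (λ i → ∑ k (λ j → g i j * h (n ∸ i) (k ∸ j)))
    ≡⟨ cong₂ _+_ (⊛-∑ f h n k) (⊛-∑ g h n k) ⟨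
  (f ⊛ h) n k + (g ⊛ h) n k
    ∎

neg : Series → Series
neg f n k = - f n k

neg-⊛ : ∀ f g → neg f ⊛ g ≐ neg (f ⊛ g)
neg-⊛ f g n k = begin
  (neg f ⊛ g) n k
    ≡⟨ ⊛-∑ (neg f) g n k ⟩
  ∑ n (λ i → ∑ k (λ j → - f i j * g (n ∸ i) (k ∸ j)))
    ≡⟨ (∑-cong n λ i _ → trans
         (∑-cong k λ j _ → sym (neg-distribˡ-* (f i j) (g (n ∸ i) (k ∸ j))))
         (∑-neg k (λ j → f i j * g (n ∸ i) (k ∸ j)))) ⟩
  ∑ n (λ i → - ∑ k (λ j → f i j * g (n ∸ i) (k ∸ j)))
    ≡⟨ ∑-neg n _ ⟩
  - ∑ n (λ i → ∑ k (λ j → f i j * g (n ∸ i) (k ∸ j)))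
    ≡⟨ cong -_ (⊛-∑ f g n k) ⟨
  - (f ⊛ g) n k
    ∎

⊛-distribˡ-⊕ : ∀ h f g → h ⊛ (f ⊕ g) ≐ (h ⊛ f) ⊕ (h ⊛ g)
⊛-distribˡ-⊕ h f g n k = begin
  (h ⊛ (f ⊕ g)) n k            ≡⟨ ⊛-comm h (f ⊕ g) n k ⟩
  ((f ⊕ g) ⊛ h) n k            ≡⟨ ⊛-distribʳ-⊕ h f g n k ⟩
  (f ⊛ h) n k + (g ⊛ h) n k    ≡⟨ cong₂ _+_ (⊛-comm f h n k) (⊛-comm g h n k) ⟩
  (h ⊛ f) n k + (h ⊛ g) n k    ∎

⊛-distribˡ-⊖ : ∀ h f g → h ⊛ (f ⊖ g) ≐ (h ⊛ f) ⊖ (h ⊛ g)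
⊛-distribˡ-⊖ h f g n k = begin
  (h ⊛ (f ⊖ g)) n k                ≡⟨ ⊛-distribˡ-⊕ h f (neg g) n k ⟩
  (h ⊛ f) n k + (h ⊛ neg g) n k    ≡⟨ cong (_+_ ((h ⊛ f) n k)) (⊛-comm h (neg g) n k) ⟩
  (h ⊛ f) n k + (neg g ⊛ h) n k    ≡⟨ cong (_+_ ((h ⊛ f) n k)) (neg-⊛ g h n k) ⟩
  (h ⊛ f) n k - (g ⊛ h) n k        ≡⟨ cong (λ z → (h ⊛ f) n k - z) (⊛-comm g h n k) ⟩
  (h ⊛ f) n k - (h ⊛ g) n k        ∎

shiftY : (ℕ → ℤ) → ℕ → ℤ
shiftY p zero    = + 0
shiftY p (suc k) = p k

-- Shifts in place of the products by x and y: `mulX-⊛` and `mulY-⊛` then serve wherever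
-- associativity of `⊛` would be wanted.
mulX mulY : Series → Series
mulX f zero    k = + 0
mulX f (suc n) k = f n k
mulY f n = shiftY (f n)

shiftY-cong : ∀ {p q} → (∀ k → p k ≡ q k) → ∀ k → shiftY p k ≡ shiftY q k
shiftY-cong p≗q zero    = refl
shiftY-cong p≗q (suc k) = p≗q k

mulY-⊛ : ∀ f g → mulY f ⊛ g ≐ mulY (f ⊛ g)
mulY-⊛ f g n zero    = trans (⊛-∑ (mulY f) g n 0) (∑-zero n λ i → *-zeroˡ (g (n ∸ i) 0))
mulY-⊛ f g n (suc k) = begin
  (mulY f ⊛ g) n (suc k)
    ≡⟨ ⊛-∑ (mulY f) g n (suc k) ⟩
  ∑ n (λ i → + 0 * g (n ∸ i) (suc k) + ∑ k (λ j → f i j * g (n ∸ i) (k ∸ j)))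
    ≡⟨ (∑-cong n λ i _ → trans (cong (_+ ∑ k (λ j → f i j * g (n ∸ i) (k ∸ j))) (*-zeroˡ (g (n ∸ i) (suc k))))
                               (+-identityˡ _)) ⟩
  ∑ n (λ i → ∑ k (λ j → f i j * g (n ∸ i) (k ∸ j)))
    ≡⟨ ⊛-∑ f g n k ⟨
  (f ⊛ g) n k
    ∎

mulX-⊛ : ∀ f g → mulX f ⊛ g ≐ mulX (f ⊛ g)
mulX-⊛ f g zero    k = trans (⊛-∑ (mulX f) g 0 k) (∑-zero k λ j → *-zeroˡ (g 0 (k ∸ j)))
mulX-⊛ f g (suc n) k = begin
  (mulX f ⊛ g) (suc n) k
    ≡⟨ ⊛-∑ (mulX f) g (suc n) k ⟩
  ∑ k (λ j → + 0 * g (suc n) (k ∸ j)) + ∑ n (λ i → ∑ k (λ j → f i j * g (n ∸ i) (k ∸ j)))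
    ≡⟨ cong₂ _+_ (∑-zero k λ j → *-zeroˡ (g (suc n) (k ∸ j))) (sym (⊛-∑ f g n k)) ⟩
  + 0 + (f ⊛ g) n k
    ≡⟨ +-identityˡ _ ⟩
  (f ⊛ g) n k
    ∎

zeroS : Series
zeroS _ _ = + 0

zeroS-⊛ : ∀ g → zeroS ⊛ g ≐ zeroS
zeroS-⊛ g n k = trans (⊛-∑ zeroS g n k) (∑-zero n λ i → ∑-zero k λ j → *-zeroˡ (g (n ∸ i) (k ∸ j)))

oneS-⊛ : ∀ g → oneS ⊛ g ≐ g
oneS-⊛ g n k = trans (⊛-∑ oneS g n k) (outer n)
  where
  inner : ∀ n k → ∑ k (λ j → oneS 0 j * g n (k ∸ j)) ≡ g n k
  inner n zero    = *-identityˡ (g n 0)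
  inner n (suc k) = begin
    + 1 * g n (suc k) + ∑ k (λ j → + 0 * g n (k ∸ j))
      ≡⟨ cong₂ _+_ (*-identityˡ (g n (suc k))) (∑-zero k λ j → *-zeroˡ (g n (k ∸ j))) ⟩
    g n (suc k) + + 0
      ≡⟨ +-identityʳ _ ⟩
    g n (suc k)
      ∎
  outer : ∀ n → ∑ n (λ i → ∑ k (λ j → oneS i j * g (n ∸ i) (k ∸ j))) ≡ g n k
  outer zero    = inner 0 k
  outer (suc n) = begin
    _
      ≡⟨ cong₂ _+_ (inner (suc n) k) (∑-zero n λ i → ∑-zero k λ j → *-zeroˡ (g (n ∸ i) (k ∸ j))) ⟩
    g (suc n) k + + 0
      ≡⟨ +-identityʳ _ ⟩
    g (suc n) k
      ∎

⊛-oneS : ∀ f → f ⊛ oneS ≐ f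
⊛-oneS f n k = trans (⊛-comm f oneS n k) (oneS-⊛ f n k)

yS-⊛ : ∀ g → yS ⊛ g ≐ mulY g
yS-⊛ g n k = begin
  (yS ⊛ g) n k          ≡⟨ ⊛-cong {g = g} yS≐ (λ _ _ → refl) n k ⟩
  (mulY oneS ⊛ g) n k   ≡⟨ mulY-⊛ oneS g n k ⟩
  mulY (oneS ⊛ g) n k   ≡⟨ shiftY-cong (oneS-⊛ g n) k ⟩
  mulY g n k            ∎
  where
  yS≐ : yS ≐ mulY oneS
  yS≐ zero    zero          = refl
  yS≐ zero    (suc zero)    = refl
  yS≐ zero    (suc (suc k)) = refl
  yS≐ (suc n) zero          = refl
  yS≐ (suc n) (suc k)       = refl

-- Lattice paths

shiftYIf : Bool → (ℕ → ℤ) → ℕ → ℤ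
shiftYIf b p = if b then shiftY p else p

mulYIf : Bool → Series → Series
mulYIf b f n = shiftYIf b (f n)

shiftY-+ : ∀ p q k → shiftY (λ k → p k + q k) k ≡ shiftY p k + shiftY q k
shiftY-+ p q zero    = refl
shiftY-+ p q (suc k) = refl

shiftY-0 : ∀ k → shiftY (λ _ → + 0) k ≡ + 0
shiftY-0 zero    = refl
shiftY-0 (suc k) = refl

shiftYIf-+ : ∀ b p q k → shiftYIf b (λ k → p k + q k) k ≡ shiftYIf b p k + shiftYIf b q k
shiftYIf-+ true  = shiftY-+
shiftYIf-+ false p q k = refl

shiftYIf-0 : ∀ b k → shiftYIf b (λ _ → + 0) k ≡ + 0
shiftYIf-0 true  = shiftY-0
shiftYIf-0 false k = refl

shiftYIf-cong : ∀ b {p q} → (∀ k → p k ≡ q k) → ∀ k → shiftYIf b p k ≡ shiftYIf b q k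
shiftYIf-cong true  = shiftY-cong
shiftYIf-cong false p≗q = p≗q

mulYIf-⊛ : ∀ b f g → mulYIf b f ⊛ g ≐ mulYIf b (f ⊛ g)
mulYIf-⊛ true  = mulY-⊛
mulYIf-⊛ false f g n k = refl

constX : (ℕ → ℤ) → Series
constX p zero    = p
constX p (suc n) k = + 0

lower : (ℕ → Series) → ℕ → Series
lower f zero    = zeroS
lower f (suc h) = f h

-- Building a T₁-avoiding permutation from left to right: h is the number of unused values below the current
-- maximum, j the number of unused values above it, x marks the values used up from above and y the ascents.
-- In rise the next entry is a left-to-right maximum, found by moving unused values one at a time from above to
-- below. In place, reached when some unused value is above, the alternative is to append the least unused value,
-- which is an ascent iff the flag holds. When nothing is left above, the weight t h accounts for the last h entries.
rise  : Series → ℕ → Series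
place : Series → Bool → ℕ → Series
rise t h zero    k = + 0
rise t h (suc j) k = constX (t h) j k + (place t false h j k + rise t (suc h) j k)
place t c h       zero    k = + 0
place t c zero    (suc j) k = shiftY (rise t zero (suc j)) k
place t c (suc h) (suc j) k = shiftY (rise t (suc h) (suc j)) k + shiftYIf c (place t true h (suc j)) k

-- The clauses at exponent 0 agree with the shifts, so the recursions of `rise` and `place` are
-- identities of series and can be multiplied by a further series.
rise-≐ : ∀ t h → rise t h ≐ mulX (constX (t h) ⊕ (place t false h ⊕ rise t (suc h)))
rise-≐ t h zero    k = refl
rise-≐ t h (suc j) k = refl

place-zero-≐ : ∀ t c → place t c 0 ≐ mulY (rise t 0)
place-zero-≐ t c zero    k = sym (shiftY-0 k)
place-zero-≐ t c (suc j) k = refl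

place-suc-≐ : ∀ t c h → place t c (suc h) ≐ mulY (rise t (suc h)) ⊕ mulYIf c (place t true h)
place-suc-≐ t c h zero    k = sym (cong₂ _+_ (shiftY-0 k) (shiftYIf-0 c k))
place-suc-≐ t c h (suc j) k = refl

rise-⊛ : ∀ t h g j k → (rise t h ⊛ g) (suc j) k ≡
  (constX (t h) ⊛ g) j k + ((place t false h ⊛ g) j k + (rise t (suc h) ⊛ g) j k)
rise-⊛ t h g j k = begin
  (rise t h ⊛ g) (suc j) k
    ≡⟨ ⊛-cong {g = g} (rise-≐ t h) (λ _ _ → refl) (suc j) k ⟩
  (mulX (constX (t h) ⊕ (place t false h ⊕ rise t (suc h))) ⊛ g) (suc j) k
    ≡⟨ mulX-⊛ (constX (t h) ⊕ (place t false h ⊕ rise t (suc h))) g (suc j) k ⟩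
  ((constX (t h) ⊕ (place t false h ⊕ rise t (suc h))) ⊛ g) j k
    ≡⟨ ⊛-distribʳ-⊕ g (constX (t h)) (place t false h ⊕ rise t (suc h)) j k ⟩
  (constX (t h) ⊛ g) j k + ((place t false h ⊕ rise t (suc h)) ⊛ g) j k
    ≡⟨ cong (_+_ ((constX (t h) ⊛ g) j k)) (⊛-distribʳ-⊕ g (place t false h) (rise t (suc h)) j k) ⟩
  (constX (t h) ⊛ g) j k + ((place t false h ⊛ g) j k + (rise t (suc h) ⊛ g) j k)
    ∎

place-zero-⊛ : ∀ t c g → place t c 0 ⊛ g ≐ mulY (rise t 0 ⊛ g)
place-zero-⊛ t c g j k =
  trans (⊛-cong {g = g} (place-zero-≐ t c) (λ _ _ → refl) j k) (mulY-⊛ (rise t 0) g j k)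

place-suc-⊛ : ∀ t c h g →
  place t c (suc h) ⊛ g ≐ mulY (rise t (suc h) ⊛ g) ⊕ mulYIf c (place t true h ⊛ g)
place-suc-⊛ t c h g j k = begin
  (place t c (suc h) ⊛ g) j k
    ≡⟨ ⊛-cong {g = g} (place-suc-≐ t c h) (λ _ _ → refl) j k ⟩
  ((mulY (rise t (suc h)) ⊕ mulYIf c (place t true h)) ⊛ g) j k
    ≡⟨ ⊛-distribʳ-⊕ g (mulY (rise t (suc h))) (mulYIf c (place t true h)) j k ⟩
  (mulY (rise t (suc h)) ⊛ g) j k + (mulYIf c (place t true h) ⊛ g) j k
    ≡⟨ cong₂ _+_ (mulY-⊛ (rise t (suc h)) g j k) (mulYIf-⊛ c (place t true h) g j k) ⟩
  mulY (rise t (suc h) ⊛ g) j k + mulYIf c (place t true h ⊛ g) j k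
    ∎

-- The functional equation of the paths

constX-oneS-suc : ∀ h → constX (oneS (suc h)) ≐ zeroS
constX-oneS-suc h zero    k = refl
constX-oneS-suc h (suc n) k = refl

constX-oneS-zero : constX (oneS 0) ≐ oneS
constX-oneS-zero zero    k = refl
constX-oneS-zero (suc n) k = refl

-- The polynomial (1 + y) p - y q, the shape of the recurrence `terminal-suc`.
comb : (ℕ → ℤ) → (ℕ → ℤ) → ℕ → ℤ
comb p q k = p k + shiftY p k - shiftY q k

comb-+ : ∀ p p′ q q′ k → comb (λ k → p k + p′ k) (λ k → q k + q′ k) k ≡ comb p q k + comb p′ q′ k
comb-+ p p′ q q′ zero    = regroup (p 0) (p′ 0)
  where
  regroup : ∀ a a′ → a + a′ + + 0 - + 0 ≡ (a + + 0 - + 0) + (a′ + + 0 - + 0)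
  regroup = solve-∀
comb-+ p p′ q q′ (suc k) = regroup (p (suc k)) (p′ (suc k)) (p k) (p′ k) (q k) (q′ k)
  where
  regroup : ∀ a a′ b b′ c c′ → a + a′ + (b + b′) - (c + c′) ≡ (a + b - c) + (a′ + b′ - c′)
  regroup = solve-∀

shiftY-comb : ∀ p q k → shiftY (comb p q) k ≡ comb (shiftY p) (shiftY q) k
shiftY-comb p q zero    = refl
shiftY-comb p q (suc k) = refl

shiftYIf-comb : ∀ b p q k → shiftYIf b (comb p q) k ≡ comb (shiftYIf b p) (shiftYIf b q) k
shiftYIf-comb true  = shiftY-comb
shiftYIf-comb false p q k = refl

comb-0 : ∀ k → comb (λ _ → + 0) (λ _ → + 0) k ≡ + 0
comb-0 zero    = refl
comb-0 (suc k) = refl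

-- `w` weights the final heights and, like `oneS`, gives weight 1 to height 0. `v` is the same
-- weight with heights measured from level 1, and `g` counts what follows the last departure from
-- height 0.
module _ (w : Series) (w₀ : ∀ k → w 0 k ≡ oneS 0 k) where

  private
    v : Series
    v = w ∘ suc
    g : Series
    g = rise v 0

  -- Uniform in the height, with `lower` absorbing the case in which no value is left below;
  -- `place-split` meets `place v c h` with `h` not yet split.
  place-lower : ∀ c h j k → place v c h j k ≡
    shiftY (rise v h j) k + shiftYIf c (lower (place v true) h j) k
  place-lower c zero    j k = trans (place-zero-≐ v c j k)
    (sym (trans (cong (_+_ (shiftY (rise v 0 j) k)) (shiftYIf-0 c k)) (+-identityʳ _)))
  place-lower c (suc h) j k = place-suc-≐ v c h j k

  constX-w-zero : constX (w 0) ≐ constX (oneS 0)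
  constX-w-zero zero    k = w₀ k
  constX-w-zero (suc n) k = refl

  -- A path that ends at a height above 0 is cut at its last departure from height 0.
  rise-split : ∀ j h k → rise w h j k ≡
    rise oneS h j k + lower (rise v) h j k + (rise oneS h ⊛ g) j k
  place-split : ∀ j c h k → place w c h j k ≡
    place oneS c h j k + lower (place v c) h j k + (place oneS c h ⊛ g) j k

  rise-split zero h k = begin
    + 0
      ≡⟨ cong₂ _+_ (cong (_+_ (+ 0)) (lower-0 h)) (trans (⊛-cong {g = g} (rise-≐ oneS h) (λ _ _ → refl) 0 k) (mulX-⊛ (constX (oneS h) ⊕ (place oneS false h ⊕ rise oneS (suc h))) g 0 k)) ⟨
    rise oneS h 0 k + lower (rise v) h 0 k + (rise oneS h ⊛ g) 0 k
      ∎
    where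
    lower-0 : ∀ h → lower (rise v) h 0 k ≡ + 0
    lower-0 zero    = refl
    lower-0 (suc h) = refl
  rise-split (suc j) zero k = begin
    constX (w 0) j k + (place w false 0 j k + rise w 1 j k)
      ≡⟨ cong₂ _+_ (constX-w-zero j k) (cong₂ _+_ (place-split j false 0 k) (rise-split j 1 k)) ⟩
    constX (oneS 0) j k + ((place oneS false 0 j k + + 0 + (place oneS false 0 ⊛ g) j k)
                          + (rise oneS 1 j k + rise v 0 j k + (rise oneS 1 ⊛ g) j k))
      ≡⟨ regroup (constX (oneS 0) j k) (place oneS false 0 j k) ((place oneS false 0 ⊛ g) j k)
                 (rise oneS 1 j k) (rise v 0 j k) ((rise oneS 1 ⊛ g) j k) ⟩
    rise oneS 0 (suc j) k + + 0 + (g j k + ((place oneS false 0 ⊛ g) j k + (rise oneS 1 ⊛ g) j k))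
      -- The summand `rise v 0 j` is `g`: the path leaves height 0 for good by moving a value below.
      -- In the product, the first factor ends by taking that value as its last maximum, which is
      -- the term 1 of `constX (oneS 0)`. Either choice costs one x and no y.
      ≡⟨ cong (λ z → rise oneS 0 (suc j) k + + 0 + (z + ((place oneS false 0 ⊛ g) j k + (rise oneS 1 ⊛ g) j k)))
           (trans (⊛-cong {g = g} constX-oneS-zero (λ _ _ → refl) j k) (oneS-⊛ g j k)) ⟨
    rise oneS 0 (suc j) k + + 0 + ((constX (oneS 0) ⊛ g) j k + ((place oneS false 0 ⊛ g) j k + (rise oneS 1 ⊛ g) j k))
      ≡⟨ cong (_+_ (rise oneS 0 (suc j) k + + 0)) (rise-⊛ oneS 0 g j k) ⟨
    rise oneS 0 (suc j) k + + 0 + (rise oneS 0 ⊛ g) (suc j) k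
      ∎
    where
    regroup : ∀ a b c d e f → a + ((b + + 0 + c) + (d + e + f)) ≡ (a + (b + d)) + + 0 + (e + (c + f))
    regroup = solve-∀
  -- `w (suc h)` is `v h` by definition, so a path that ends right here, above height 0, belongs to
  -- the lowered term; `oneS (suc h)` contributes 0.
  rise-split (suc j) (suc h) k = begin
    constX (v h) j k + (place w false (suc h) j k + rise w (suc (suc h)) j k)
      ≡⟨ cong (_+_ (constX (v h) j k)) (cong₂ _+_ (place-split j false (suc h) k) (rise-split j (suc (suc h)) k)) ⟩
    constX (v h) j k + ((P + place v false h j k + Pg) + (R + rise v (suc h) j k + Rg))
      ≡⟨ regroup (constX (v h) j k) P (place v false h j k) Pg R (rise v (suc h) j k) Rg ⟩
    (+ 0 + (P + R)) + rise v h (suc j) k + (+ 0 + (Pg + Rg))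
      ≡⟨ cong₂ (λ y z → (y + (P + R)) + rise v h (suc j) k + (z + (Pg + Rg)))
           (constX-oneS-suc h j k)
           (trans (⊛-cong {g = g} (constX-oneS-suc h) (λ _ _ → refl) j k) (zeroS-⊛ g j k)) ⟨
    rise oneS (suc h) (suc j) k + rise v h (suc j) k + ((constX (oneS (suc h)) ⊛ g) j k + (Pg + Rg))
      ≡⟨ cong (_+_ (rise oneS (suc h) (suc j) k + rise v h (suc j) k)) (rise-⊛ oneS (suc h) g j k) ⟨
    rise oneS (suc h) (suc j) k + rise v h (suc j) k + (rise oneS (suc h) ⊛ g) (suc j) k
      ∎
    where
    P = place oneS false (suc h) j k
    R = rise oneS (suc (suc h)) j k
    Pg = (place oneS false (suc h) ⊛ g) j k
    Rg = (rise oneS (suc (suc h)) ⊛ g) j k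
    regroup : ∀ a p p′ pg r r′ rg →
      a + ((p + p′ + pg) + (r + r′ + rg)) ≡ (+ 0 + (p + r)) + (a + (p′ + r′)) + (+ 0 + (pg + rg))
    regroup = solve-∀

  place-split zero c h k = begin
    + 0
      ≡⟨ cong₂ _+_ (cong (_+_ (+ 0)) (lower-0 h)) (⊛-0 c h k) ⟨
    place oneS c h 0 k + lower (place v c) h 0 k + (place oneS c h ⊛ g) 0 k
      ∎
    where
    lower-0 : ∀ h → lower (place v c) h 0 k ≡ + 0
    lower-0 zero    = refl
    lower-0 (suc h) = refl
    rise-⊛-0 : ∀ h k → (rise oneS h ⊛ g) 0 k ≡ + 0
    rise-⊛-0 h k = trans (⊛-cong {g = g} (rise-≐ oneS h) (λ _ _ → refl) 0 k) (mulX-⊛ (constX (oneS h) ⊕ (place oneS false h ⊕ rise oneS (suc h))) g 0 k)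
    ⊛-0 : ∀ c h k → (place oneS c h ⊛ g) 0 k ≡ + 0
    ⊛-0 c zero k = trans (place-zero-⊛ oneS c g 0 k) (trans (shiftY-cong (rise-⊛-0 0) k) (shiftY-0 k))
    ⊛-0 c (suc h) k = trans (place-suc-⊛ oneS c h g 0 k) (cong₂ _+_
      (trans (shiftY-cong (rise-⊛-0 (suc h)) k) (shiftY-0 k))
      (trans (shiftYIf-cong c (⊛-0 true h) k) (shiftYIf-0 c k)))
  place-split (suc j) c zero k = begin
    shiftY (rise w 0 (suc j)) k
      ≡⟨ shiftY-cong (rise-split (suc j) 0) k ⟩
    shiftY (λ k → rise oneS 0 (suc j) k + + 0 + (rise oneS 0 ⊛ g) (suc j) k) k
      ≡⟨ shiftY-+ (λ k → rise oneS 0 (suc j) k + + 0) ((rise oneS 0 ⊛ g) (suc j)) k ⟩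
    shiftY (λ k → rise oneS 0 (suc j) k + + 0) k + shiftY ((rise oneS 0 ⊛ g) (suc j)) k
      ≡⟨ cong₂ _+_ (shiftY-+ (rise oneS 0 (suc j)) (λ _ → + 0) k) (sym (place-zero-⊛ oneS c g (suc j) k)) ⟩
    shiftY (rise oneS 0 (suc j)) k + shiftY (λ _ → + 0) k + (place oneS c 0 ⊛ g) (suc j) k
      ≡⟨ cong (λ z → shiftY (rise oneS 0 (suc j)) k + z + (place oneS c 0 ⊛ g) (suc j) k) (shiftY-0 k) ⟩
    shiftY (rise oneS 0 (suc j)) k + + 0 + (place oneS c 0 ⊛ g) (suc j) k
      ∎
  place-split (suc j) c (suc h) k = begin
    shiftY (rise w (suc h) (suc j)) k + shiftYIf c (place w true h (suc j)) k
      ≡⟨ cong₂ _+_ (shiftY-cong (rise-split (suc j) (suc h)) k) (shiftYIf-cong c (place-split (suc j) true h) k) ⟩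
    shiftY (λ k → r k + r′ k + rg k) k + shiftYIf c (λ k → p k + p′ k + pg k) k
      ≡⟨ cong₂ _+_
           (trans (shiftY-+ (λ k → r k + r′ k) rg k) (cong (_+ shiftY rg k) (shiftY-+ r r′ k)))
           (trans (shiftYIf-+ c (λ k → p k + p′ k) pg k) (cong (_+ shiftYIf c pg k) (shiftYIf-+ c p p′ k))) ⟩
    (shiftY r k + shiftY r′ k + shiftY rg k) + (shiftYIf c p k + shiftYIf c p′ k + shiftYIf c pg k)
      ≡⟨ regroup (shiftY r k) (shiftY r′ k) (shiftY rg k) (shiftYIf c p k) (shiftYIf c p′ k) (shiftYIf c pg k) ⟩
    (shiftY r k + shiftYIf c p k) + (shiftY r′ k + shiftYIf c p′ k) + (shiftY rg k + shiftYIf c pg k)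
      ≡⟨ cong₂ (λ y z → (shiftY r k + shiftYIf c p k) + y + z)
           (place-lower c h (suc j) k) (place-suc-⊛ oneS c h g (suc j) k) ⟨
    place oneS c (suc h) (suc j) k + place v c h (suc j) k + (place oneS c (suc h) ⊛ g) (suc j) k
      ∎
    where
    r  = rise oneS (suc h) (suc j)
    r′ = rise v h (suc j)
    rg = (rise oneS (suc h) ⊛ g) (suc j)
    p  = place oneS true h (suc j)
    p′ = lower (place v true) h (suc j)
    pg = (place oneS true h ⊛ g) (suc j)
    regroup : ∀ r r′ rg p p′ pg → (r + r′ + rg) + (p + p′ + pg) ≡ (r + p) + (r′ + p′) + (rg + pg)
    regroup = solve-∀

  module _ (v-w : ∀ h k → v h k ≡ w h k + shiftY (w h) k - shiftY (oneS h) k) where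

    -- Every clause of `rise` and `place` is linear in the weights, so the relation `v-w` passes
    -- from the weights to the series.
    rise-comb  : ∀ j h k → rise v h j k ≡ comb (rise w h j) (rise oneS h j) k
    place-comb : ∀ j c h k → place v c h j k ≡ comb (place w c h j) (place oneS c h j) k

    rise-comb zero    h k = sym (comb-0 k)
    rise-comb (suc j) h k = begin
      constX (v h) j k + (place v false h j k + rise v (suc h) j k)
        ≡⟨ cong₂ _+_ (const j) (cong₂ _+_ (place-comb j false h k) (rise-comb j (suc h) k)) ⟩
      comb (constX (w h) j) (constX (oneS h) j) k
        + (comb (place w false h j) (place oneS false h j) k + comb (rise w (suc h) j) (rise oneS (suc h) j) k)
        ≡⟨ cong (_+_ (comb (constX (w h) j) (constX (oneS h) j) k))
             (comb-+ (place w false h j) (rise w (suc h) j) (place oneS false h j) (rise oneS (suc h) j) k) ⟨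
      comb (constX (w h) j) (constX (oneS h) j) k
        + comb (λ k → place w false h j k + rise w (suc h) j k) (λ k → place oneS false h j k + rise oneS (suc h) j k) k
        ≡⟨ comb-+ (constX (w h) j) (λ k → place w false h j k + rise w (suc h) j k)
                  (constX (oneS h) j) (λ k → place oneS false h j k + rise oneS (suc h) j k) k ⟨
      comb (rise w h (suc j)) (rise oneS h (suc j)) k
        ∎
      where
      const : ∀ j → constX (v h) j k ≡ comb (constX (w h) j) (constX (oneS h) j) k
      const zero    = v-w h k
      const (suc j) = sym (comb-0 k)

    place-comb zero    c h k = sym (comb-0 k)
    place-comb (suc j) c zero k = trans
      (shiftY-cong (rise-comb (suc j) 0) k)
      (shiftY-comb (rise w 0 (suc j)) (rise oneS 0 (suc j)) k)
    place-comb (suc j) c (suc h) k = begin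
      shiftY (rise v (suc h) (suc j)) k + shiftYIf c (place v true h (suc j)) k
        ≡⟨ cong₂ _+_ (shiftY-cong (rise-comb (suc j) (suc h)) k) (shiftYIf-cong c (place-comb (suc j) true h) k) ⟩
      shiftY (comb r r′) k + shiftYIf c (comb p p′) k
        ≡⟨ cong₂ _+_ (shiftY-comb r r′ k) (shiftYIf-comb c p p′ k) ⟩
      comb (shiftY r) (shiftY r′) k + comb (shiftYIf c p) (shiftYIf c p′) k
        ≡⟨ comb-+ (shiftY r) (shiftYIf c p) (shiftY r′) (shiftYIf c p′) k ⟨
      comb (place w c (suc h) (suc j)) (place oneS c (suc h) (suc j)) k
        ∎
      where
      r  = rise w (suc h) (suc j)
      r′ = rise oneS (suc h) (suc j)
      p  = place w true h (suc j)
      p′ = place oneS true h (suc j)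

    -- From height 0 no path stays above 0, so the middle term of `rise-split` vanishes; `rise-comb`
    -- expresses `g` by the two series themselves, which closes the equation.
    rise-equation : rise w 0 ≐ rise oneS 0 ⊕ (rise oneS 0 ⊛ ((rise w 0 ⊕ mulY (rise w 0)) ⊖ mulY (rise oneS 0)))
    rise-equation n k = trans (rise-split n 0 k) (cong₂ _+_ (+-identityʳ (rise oneS 0 n k))
      (⊛-cong {f = rise oneS 0} (λ _ _ → refl) (λ j → rise-comb j 0) n k))

-- The s entries after the maximum n are extreme among the entries from them on, so each of them but the last is
-- freely the least (followed by an ascent) or the greatest (followed by a descent).
terminal : Series
terminal zero          = oneS 0
terminal (suc zero)    = oneS 0
terminal (suc (suc s)) k = shiftY (terminal (suc s)) k + terminal (suc s) k

-- The weight is multiplied by 1 + y at every step but the one from 0 to 1, where it stays 1;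
-- `oneS h` is nonzero only for `h` = 0 and takes off the surplus y there.
terminal-suc : ∀ h k → terminal (suc h) k ≡ terminal h k + shiftY (terminal h) k - shiftY (oneS h) k
terminal-suc zero    k = cancel (oneS 0 k) (shiftY (oneS 0) k)
  where
  cancel : ∀ a b → a ≡ a + b - b
  cancel = solve-∀
terminal-suc (suc h) k = trans (commute (terminal (suc h) k) (shiftY (terminal (suc h)) k))
  (cong (λ z → terminal (suc h) k + shiftY (terminal (suc h)) k - z) (sym (shiftY-0 k)))
  where
  commute : ∀ a b → b + a ≡ a + b - + 0
  commute = solve-∀

-- The hypothesis is substituted only in f times 1. The products of `e` with `f` and with itself
-- stay atomic, and what remains is linear arithmetic in four coefficients.
cleared-equation : ∀ {f e} → f ≐ e ⊕ (e ⊛ ((f ⊕ mulY f) ⊖ mulY e)) →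
  f ⊛ ((oneS ⊖ e) ⊖ (yS ⊛ e)) ≐ e ⊛ (oneS ⊖ (yS ⊛ e))
cleared-equation {f} {e} f≐ n k = begin
  (f ⊛ ((oneS ⊖ e) ⊖ (yS ⊛ e))) n k
    ≡⟨ ⊛-distribˡ-⊖ f (oneS ⊖ e) (yS ⊛ e) n k ⟩
  (f ⊛ (oneS ⊖ e)) n k - (f ⊛ (yS ⊛ e)) n k
    ≡⟨ cong₂ _-_ (⊛-distribˡ-⊖ f oneS e n k) (⊛-yS f e) ⟩
  (f ⊛ oneS) n k - (f ⊛ e) n k - shiftY ((f ⊛ e) n) k
    ≡⟨ cong₂ (λ a b → a - (f ⊛ e) n k - b) (trans (⊛-oneS f n k) (f≐ n k)) (shiftY-cong (⊛-comm f e n) k) ⟩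
  e n k + (e ⊛ ((f ⊕ mulY f) ⊖ mulY e)) n k - (f ⊛ e) n k - shiftY ((e ⊛ f) n) k
    ≡⟨ cong₂ (λ a b → e n k + a - b - shiftY ((e ⊛ f) n) k) expand (⊛-comm f e n k) ⟩
  e n k + ((e ⊛ f) n k + shiftY ((e ⊛ f) n) k - shiftY ((e ⊛ e) n) k) - (e ⊛ f) n k - shiftY ((e ⊛ f) n) k
    ≡⟨ cancel (e n k) ((e ⊛ f) n k) (shiftY ((e ⊛ f) n) k) (shiftY ((e ⊛ e) n) k) ⟩
  e n k - shiftY ((e ⊛ e) n) k
    ≡⟨ cong₂ _-_ (⊛-oneS e n k) (⊛-yS e e) ⟨
  (e ⊛ oneS) n k - (e ⊛ (yS ⊛ e)) n k
    ≡⟨ ⊛-distribˡ-⊖ e oneS (yS ⊛ e) n k ⟨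
  (e ⊛ (oneS ⊖ (yS ⊛ e))) n k
    ∎
  where
  ⊛-mulY : ∀ f g → (f ⊛ mulY g) n k ≡ shiftY ((f ⊛ g) n) k
  ⊛-mulY f g = trans (⊛-comm f (mulY g) n k) (trans (mulY-⊛ g f n k) (shiftY-cong (⊛-comm g f n) k))
  ⊛-yS : ∀ f g → (f ⊛ (yS ⊛ g)) n k ≡ shiftY ((f ⊛ g) n) k
  ⊛-yS f g = trans (⊛-cong {f = f} (λ _ _ → refl) (yS-⊛ g) n k) (⊛-mulY f g)
  expand : (e ⊛ ((f ⊕ mulY f) ⊖ mulY e)) n k ≡ (e ⊛ f) n k + shiftY ((e ⊛ f) n) k - shiftY ((e ⊛ e) n) k
  expand = trans (⊛-distribˡ-⊖ e (f ⊕ mulY f) (mulY e) n k)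
    (cong₂ _-_ (trans (⊛-distribˡ-⊕ e f (mulY f) n k) (cong (_+_ ((e ⊛ f) n k)) (⊛-mulY e f))) (⊛-mulY e e))
  cancel : ∀ a b c d → a + (b + c - d) - b - c ≡ a - d
  cancel = solve-∀

-- Avoidance of T₁ as a left-to-right condition

T-not : ∀ {b} → T (not b) → ¬ T b
T-not {false} _ ()

¬T-not : ∀ {b} → ¬ T b → T (not b)
¬T-not {false} _ = tt
¬T-not {true}  ¬t = ¬t tt

T-injective : ∀ {a b} → (T a → T b) → (T b → T a) → a ≡ b
T-injective {false} {false} f g = refl
T-injective {true}  {true}  f g = refl
T-injective {false} {true}  f g = ⊥-elim (g tt)
T-injective {true}  {false} f g = ⊥-elim (f tt)

T-anyᵇ⁻ : {A : Set} {p : A → Bool} (xs : List A) → T (anyᵇ p xs) → ∃ λ x → x ∈ xs × T (p x)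
T-anyᵇ⁻ {p = p} (x ∷ xs) t with p x in eq
... | true  = x , here refl , subst T (sym eq) tt
... | false with T-anyᵇ⁻ xs t
...   | y , y∈ , py = y , there y∈ , py

T-anyᵇ⁺ : {A : Set} {p : A → Bool} {x : A} {xs : List A} → x ∈ xs → T (p x) → T (anyᵇ p xs)
T-anyᵇ⁺ (here refl) px = from T-∨ (inj₁ px)
T-anyᵇ⁺ {p = p} {xs = y ∷ _} (there x∈) px = from (T-∨ {p y}) (inj₂ (T-anyᵇ⁺ x∈ px))

T-allᵇ⁻ : {A : Set} (p : A → Bool) {x : A} {xs : List A} → T (allᵇ p xs) → x ∈ xs → T (p x)
T-allᵇ⁻ p t (here refl) = proj₁ (to T-∧ t)
T-allᵇ⁻ p {xs = y ∷ _} t (there x∈) = T-allᵇ⁻ p (proj₂ (to (T-∧ {p y}) t)) x∈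

T-allᵇ⁺ : {A : Set} (p : A → Bool) (xs : List A) → (∀ {x} → x ∈ xs → T (p x)) → T (allᵇ p xs)
T-allᵇ⁺ p []       f = tt
T-allᵇ⁺ p (x ∷ xs) f = from T-∧ (f (here refl) , T-allᵇ⁺ p xs (f ∘ there))

∈-subseqs⁻ : ∀ k σ {w} → w ∈ subseqs k σ → w ⊆ σ
∈-subseqs⁻ zero    σ       (here refl) = minimum σ
∈-subseqs⁻ (suc k) (x ∷ σ) w∈ with ∈-++⁻ (map (x ∷_) (subseqs k σ)) w∈
... | inj₂ w∈′ = x ∷ʳ ∈-subseqs⁻ (suc k) σ w∈′
... | inj₁ w∈′ with ∈-map⁻ (x ∷_) w∈′
...   | v , v∈ , refl = refl ∷ ∈-subseqs⁻ k σ v∈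

∈-subseqs⁺ : ∀ {w σ} → w ⊆ σ → w ∈ subseqs (length w) σ
∈-subseqs⁺ []                        = here refl
∈-subseqs⁺ {[]}    (x ∷ʳ τ)          = here refl
∈-subseqs⁺ {y ∷ w} {x ∷ σ} (x ∷ʳ τ)   = ∈-++⁺ʳ (map (x ∷_) (subseqs (length w) σ)) (∈-subseqs⁺ τ)
∈-subseqs⁺ {y ∷ w} {_ ∷ σ} (refl ∷ τ) = ∈-++⁺ˡ (∈-map⁺ (y ∷_) (∈-subseqs⁺ τ))

T-contains⁻ : ∀ σ τ → T (contains σ τ) → ∃ λ w → w ⊆ σ × T (orderIso w τ)
T-contains⁻ σ τ t with T-anyᵇ⁻ (subseqs (length τ) σ) t
... | w , w∈ , iso = w , ∈-subseqs⁻ (length τ) σ w∈ , iso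

T-contains⁺ : ∀ {w σ} τ → w ⊆ σ → length w ≡ length τ → T (orderIso w τ) → T (contains σ τ)
T-contains⁺ {w} {σ} τ w⊆σ eq iso =
  T-anyᵇ⁺ {p = λ s → orderIso s τ} (subst (λ k → w ∈ subseqs k σ) eq (∈-subseqs⁺ w⊆σ)) iso

sameOrder : ℕ × ℕ → ℕ × ℕ → Bool
sameOrder (a , c) (b , d) = ((a <ᵇ b) ⇔ᵇ (c <ᵇ d)) ∧ ((b <ᵇ a) ⇔ᵇ (d <ᵇ c))

⇔ᵇ-T : ∀ {a b} → T (a ⇔ᵇ b) → T b → T a
⇔ᵇ-T {true}  _ _ = tt
⇔ᵇ-T {false} t b = T-not t b

sameOrder⁻ : ∀ a b c d → T (sameOrder (a , c) (b , d)) → (T (c <ᵇ d) → a < b) × (T (d <ᵇ c) → b < a)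
sameOrder⁻ a b c d t = (λ p → ℕ.<ᵇ⇒< a b (⇔ᵇ-T (proj₁ both) p)) , (λ p → ℕ.<ᵇ⇒< b a (⇔ᵇ-T (proj₂ both) p))
  where both = to (T-∧ {(a <ᵇ b) ⇔ᵇ (c <ᵇ d)}) t

<⇒<ᵇ≡true : ∀ {m n} → m < n → (m <ᵇ n) ≡ true
<⇒<ᵇ≡true m<n = to T-≡ (ℕ.<⇒<ᵇ m<n)

≤⇒<ᵇ≡false : ∀ {m n} → n ≤ m → (m <ᵇ n) ≡ false
≤⇒<ᵇ≡false {m} {n} n≤m with m <ᵇ n in eq
... | false = refl
... | true  = contradiction (ℕ.<ᵇ⇒< m n (subst T (sym eq) tt)) (ℕ.≤⇒≯ n≤m)

sameOrder-< : ∀ c d {a b} → a < b → T (c <ᵇ d) → T (sameOrder (a , c) (b , d))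
sameOrder-< c d a<b c<d rewrite <⇒<ᵇ≡true a<b | to T-≡ c<d
  | ≤⇒<ᵇ≡false (ℕ.<⇒≤ a<b) | ≤⇒<ᵇ≡false (ℕ.<⇒≤ (ℕ.<ᵇ⇒< c d c<d)) = tt

sameOrder-> : ∀ c d {a b} → b < a → T (d <ᵇ c) → T (sameOrder (a , c) (b , d))
sameOrder-> c d b<a d<c rewrite <⇒<ᵇ≡true b<a | to T-≡ d<c
  | ≤⇒<ᵇ≡false (ℕ.<⇒≤ b<a) | ≤⇒<ᵇ≡false (ℕ.<⇒≤ (ℕ.<ᵇ⇒< d c d<c)) = tt

Between : ℕ → ℕ → ℕ → Set
Between b c d = c < b × b < d ⊎ d < b × b < c

-- The four patterns of T₁ are exactly the words a b c d in which b is smaller than a and lies between c and d.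
record Forbidden (σ : List ℕ) : Set where
  constructor forbidden
  field
    {a b c d}  : ℕ
    occurrence : a ∷ b ∷ c ∷ d ∷ [] ⊆ σ
    b<a        : b < a
    between    : Between b c d

pattern τ₁ = here refl
pattern τ₂ = there (here refl)
pattern τ₃ = there (there (here refl))
pattern τ₄ = there (there (there (here refl)))

-- Comparing the second letter with the other three already yields `b < a` and `Between b c d` for
-- each pattern.
orderIso⁻ : ∀ a b c d {p q r s} → T (orderIso (a ∷ b ∷ c ∷ d ∷ []) (p ∷ q ∷ r ∷ s ∷ [])) →
  T (sameOrder (a , p) (b , q)) × T (sameOrder (b , q) (c , r)) × T (sameOrder (b , q) (d , s))
orderIso⁻ a b c d {p} {q} {r} {s} t
  with to (T-∧ {sameOrderWith (a , p) ((b , q) ∷ (c , r) ∷ (d , s) ∷ [])}) t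
... | fromA , rest with to (T-∧ {sameOrder (a , p) (b , q)}) fromA
                      | to (T-∧ {sameOrderWith (b , q) ((c , r) ∷ (d , s) ∷ [])}) rest
... | ab , _ | fromB , _ with to (T-∧ {sameOrder (b , q) (c , r)}) fromB
... | bc , bd = ab , bc , proj₁ (to (T-∧ {sameOrder (b , q) (d , s)}) bd)

orderIso⁺ : ∀ x y z w →
  T (sameOrder x y) → T (sameOrder x z) → T (sameOrder x w) →
  T (sameOrder y z) → T (sameOrder y w) → T (sameOrder z w) →
  T (orderIso (map proj₁ (x ∷ y ∷ z ∷ w ∷ [])) (map proj₂ (x ∷ y ∷ z ∷ w ∷ [])))
orderIso⁺ x y z w xy xz xw yz yw zw =
  from (T-∧ {sameOrderWith x (y ∷ z ∷ w ∷ [])})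
    (row₃ x y z w xy xz xw , from (T-∧ {sameOrderWith y (z ∷ w ∷ [])})
      (row₂ y z w yz yw , from (T-∧ {sameOrderWith z (w ∷ [])}) (row₁ z w zw , tt)))
  where
  row₁ : ∀ x y → T (sameOrder x y) → T (sameOrderWith x (y ∷ []))
  row₁ x y h = from (T-∧ {sameOrder x y}) (h , tt)
  row₂ : ∀ x y z → T (sameOrder x y) → T (sameOrder x z) → T (sameOrderWith x (y ∷ z ∷ []))
  row₂ x y z h i = from (T-∧ {sameOrder x y}) (h , row₁ x z i)
  row₃ : ∀ x y z w → T (sameOrder x y) → T (sameOrder x z) → T (sameOrder x w) →
    T (sameOrderWith x (y ∷ z ∷ w ∷ []))
  row₃ x y z w h i j = from (T-∧ {sameOrder x y}) (h , row₂ x z w i j)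

pattern-word : ∀ {τ} w → τ ∈ T₁ → T (orderIso w τ) →
  ∃ λ a → ∃ λ b → ∃ λ c → ∃ λ d → w ≡ a ∷ b ∷ c ∷ d ∷ [] × b < a × Between b c d
pattern-word (a ∷ b ∷ c ∷ d ∷ []) τ₁ t with orderIso⁻ a b c d {3} {2} {1} {4} t
... | ab , bc , bd = a , b , c , d , refl , proj₂ (sameOrder⁻ a b 3 2 ab) tt ,
  inj₁ (proj₂ (sameOrder⁻ b c 2 1 bc) tt , proj₁ (sameOrder⁻ b d 2 4 bd) tt)
pattern-word (a ∷ b ∷ c ∷ d ∷ []) τ₂ t with orderIso⁻ a b c d {3} {2} {4} {1} t
... | ab , bc , bd = a , b , c , d , refl , proj₂ (sameOrder⁻ a b 3 2 ab) tt ,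
  inj₂ (proj₂ (sameOrder⁻ b d 2 1 bd) tt , proj₁ (sameOrder⁻ b c 2 4 bc) tt)
pattern-word (a ∷ b ∷ c ∷ d ∷ []) τ₃ t with orderIso⁻ a b c d {4} {2} {1} {3} t
... | ab , bc , bd = a , b , c , d , refl , proj₂ (sameOrder⁻ a b 4 2 ab) tt ,
  inj₁ (proj₂ (sameOrder⁻ b c 2 1 bc) tt , proj₁ (sameOrder⁻ b d 2 3 bd) tt)
pattern-word (a ∷ b ∷ c ∷ d ∷ []) τ₄ t with orderIso⁻ a b c d {4} {2} {3} {1} t
... | ab , bc , bd = a , b , c , d , refl , proj₂ (sameOrder⁻ a b 4 2 ab) tt ,
  inj₂ (proj₂ (sameOrder⁻ b d 2 1 bd) tt , proj₁ (sameOrder⁻ b c 2 3 bc) tt)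
pattern-word [] τ₁ ()
pattern-word [] τ₂ ()
pattern-word [] τ₃ ()
pattern-word [] τ₄ ()
pattern-word (_ ∷ []) τ₁ ()
pattern-word (_ ∷ []) τ₂ ()
pattern-word (_ ∷ []) τ₃ ()
pattern-word (_ ∷ []) τ₄ ()
pattern-word (_ ∷ _ ∷ []) τ₁ ()
pattern-word (_ ∷ _ ∷ []) τ₂ ()
pattern-word (_ ∷ _ ∷ []) τ₃ ()
pattern-word (_ ∷ _ ∷ []) τ₄ ()
pattern-word (_ ∷ _ ∷ _ ∷ []) τ₁ ()
pattern-word (_ ∷ _ ∷ _ ∷ []) τ₂ ()
pattern-word (_ ∷ _ ∷ _ ∷ []) τ₃ ()
pattern-word (_ ∷ _ ∷ _ ∷ []) τ₄ ()
pattern-word (_ ∷ _ ∷ _ ∷ _ ∷ _ ∷ _) τ₁ ()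
pattern-word (_ ∷ _ ∷ _ ∷ _ ∷ _ ∷ _) τ₂ ()
pattern-word (_ ∷ _ ∷ _ ∷ _ ∷ _ ∷ _) τ₃ ()
pattern-word (_ ∷ _ ∷ _ ∷ _ ∷ _ ∷ _) τ₄ ()

-- `Between` tells which of `c` and `d` is smaller, and the comparison of `a` with the larger one
-- selects the pattern. A tie with `a` would match no pattern.
word-pattern : ∀ {a b c d} → b < a → a ≢ c → a ≢ d → Between b c d →
  ∃ λ τ → τ ∈ T₁ × length τ ≡ 4 × T (orderIso (a ∷ b ∷ c ∷ d ∷ []) τ)
word-pattern {a} {b} {c} {d} b<a a≢c a≢d (inj₁ (c<b , b<d)) with ℕ.<-cmp a d
... | tri≈ _ a≡d _ = contradiction a≡d a≢d
... | tri< a<d _ _ = _ , τ₁ , refl , orderIso⁺ (a , 3) (b , 2) (c , 1) (d , 4)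
  (sameOrder-> 3 2 b<a tt) (sameOrder-> 3 1 (ℕ.<-trans c<b b<a) tt) (sameOrder-< 3 4 a<d tt)
  (sameOrder-> 2 1 c<b tt) (sameOrder-< 2 4 b<d tt) (sameOrder-< 1 4 (ℕ.<-trans c<b b<d) tt)
... | tri> _ _ d<a = _ , τ₃ , refl , orderIso⁺ (a , 4) (b , 2) (c , 1) (d , 3)
  (sameOrder-> 4 2 b<a tt) (sameOrder-> 4 1 (ℕ.<-trans c<b b<a) tt) (sameOrder-> 4 3 d<a tt)
  (sameOrder-> 2 1 c<b tt) (sameOrder-< 2 3 b<d tt) (sameOrder-< 1 3 (ℕ.<-trans c<b b<d) tt)
word-pattern {a} {b} {c} {d} b<a a≢c a≢d (inj₂ (d<b , b<c)) with ℕ.<-cmp a c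
... | tri≈ _ a≡c _ = contradiction a≡c a≢c
... | tri< a<c _ _ = _ , τ₂ , refl , orderIso⁺ (a , 3) (b , 2) (c , 4) (d , 1)
  (sameOrder-> 3 2 b<a tt) (sameOrder-< 3 4 a<c tt) (sameOrder-> 3 1 (ℕ.<-trans d<b b<a) tt)
  (sameOrder-< 2 4 b<c tt) (sameOrder-> 2 1 d<b tt) (sameOrder-> 4 1 (ℕ.<-trans d<b b<c) tt)
... | tri> _ _ c<a = _ , τ₄ , refl , orderIso⁺ (a , 4) (b , 2) (c , 3) (d , 1)
  (sameOrder-> 4 2 b<a tt) (sameOrder-> 4 3 c<a tt) (sameOrder-> 4 1 (ℕ.<-trans d<b b<a) tt)
  (sameOrder-< 2 3 b<c tt) (sameOrder-> 2 1 d<b tt) (sameOrder-> 3 1 (ℕ.<-trans d<b b<c) tt)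

head-apart : ∀ {x y σ} {w : List ℕ} → Unique σ → x ∷ w ⊆ σ → y ∈ w → x ≢ y
head-apart (_ ∷ u)  (_ ∷ʳ τ)   y∈ = head-apart u τ y∈
head-apart (x≢ ∷ _) (refl ∷ τ) y∈ = All.lookup x≢ (lookup τ y∈)

avoidsT₁⇒¬Forbidden : ∀ {σ} → Unique σ → T (avoidsT₁ σ) → ¬ Forbidden σ
avoidsT₁⇒¬Forbidden uniq t (forbidden occ b<a btw)
  with word-pattern b<a (head-apart uniq occ (there (here refl))) (head-apart uniq occ (there (there (here refl)))) btw
... | τ , τ∈ , len , iso = T-not (T-allᵇ⁻ (avoids _) t τ∈) (T-contains⁺ τ occ (sym len) iso)

¬Forbidden⇒avoidsT₁ : ∀ {σ} → ¬ Forbidden σ → T (avoidsT₁ σ)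
¬Forbidden⇒avoidsT₁ {σ} ¬f = T-allᵇ⁺ (avoids σ) T₁ λ {τ} τ∈ → ¬T-not λ t → occurs τ∈ (T-contains⁻ σ τ t)
  where
  occurs : ∀ {τ} → τ ∈ T₁ → ∃ (λ w → w ⊆ σ × T (orderIso w τ)) → ⊥
  occurs τ∈ (w , w⊆σ , iso) with pattern-word w τ∈ iso
  ... | _ , _ , _ , _ , refl , b<a , btw = ¬f (forbidden w⊆σ b<a btw)

-- The scan with the running maximum

straddled : ℕ → List ℕ → Bool
straddled y ys = anyᵇ (_<ᵇ y) ys ∧ anyᵇ (y <ᵇ_) ys

-- Scans a permutation with the running maximum m: an entry that is not a left-to-right maximum must not be
-- straddled by the entries after it.
admissible : ℕ → List ℕ → Bool
admissible m []       = true
admissible m (y ∷ ys) = if m <ᵇ y then admissible y ys else not (straddled y ys) ∧ admissible m ys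

straddled⁻ : ∀ y ys → T (straddled y ys) → ∃ λ c → ∃ λ d → c ∷ d ∷ [] ⊆ ys × Between y c d
straddled⁻ y ys t with to (T-∧ {anyᵇ (_<ᵇ y) ys}) t
... | lo , hi with T-anyᵇ⁻ ys lo | T-anyᵇ⁻ ys hi
...   | l , l∈ , l< | h , h∈ , h> = order l∈ h∈ (ℕ.<ᵇ⇒< l y l<) (ℕ.<ᵇ⇒< y h h>)
  where
  order : ∀ {l h ys} → l ∈ ys → h ∈ ys → l < y → y < h → ∃ λ c → ∃ λ d → c ∷ d ∷ [] ⊆ ys × Between y c d
  order (here refl) (here refl) l<y y<h = contradiction l<y (ℕ.<-asym y<h)
  order (here refl) (there h∈) l<y y<h = _ , _ , refl ∷ from∈ h∈ , inj₁ (l<y , y<h)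
  order (there l∈) (here refl) l<y y<h = _ , _ , refl ∷ from∈ l∈ , inj₂ (l<y , y<h)
  order (there l∈) (there h∈) l<y y<h with order l∈ h∈ l<y y<h
  ... | c , d , τ , btw = c , d , _ ∷ʳ τ , btw

straddled⁺ : ∀ {y ys l h} → l ∈ ys → h ∈ ys → l < y → y < h → T (straddled y ys)
straddled⁺ l∈ h∈ l<y y<h = from T-∧ (T-anyᵇ⁺ l∈ (ℕ.<⇒<ᵇ l<y) , T-anyᵇ⁺ h∈ (ℕ.<⇒<ᵇ y<h))

straddled-between : ∀ {y c d ys} → c ∷ d ∷ [] ⊆ ys → Between y c d → T (straddled y ys)
straddled-between τ (inj₁ (c<y , y<d)) = straddled⁺ (lookup τ (here refl)) (lookup τ (there (here refl))) c<y y<d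
straddled-between τ (inj₂ (d<y , y<c)) = straddled⁺ (lookup τ (there (here refl))) (lookup τ (here refl)) d<y y<c

-- The running maximum can stand for all earlier entries: `a` only has to exceed `b`, so any larger
-- entry before `b` may replace it.
admissible⇒¬Forbidden : ∀ m ys → T (admissible m ys) → ¬ Forbidden (m ∷ ys)
admissible⇒¬Forbidden m []       t (forbidden (_ ∷ ()) _ _)
admissible⇒¬Forbidden m []       t (forbidden (_ ∷ʳ ()) _ _)
admissible⇒¬Forbidden m (y ∷ ys) t f with m <ᵇ y in eq
... | true  = admissible⇒¬Forbidden y ys t (drop f)
  where
  m<y : m < y
  m<y = ℕ.<ᵇ⇒< m y (subst T (sym eq) tt)
  drop : Forbidden (m ∷ y ∷ ys) → Forbidden (y ∷ ys)
  drop (forbidden (_ ∷ʳ τ) b<a btw)            = forbidden τ b<a btw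
  drop (forbidden (refl ∷ (_ ∷ʳ τ)) b<a btw)   = forbidden (refl ∷ τ) (ℕ.<-trans b<a m<y) btw
  drop (forbidden (refl ∷ (refl ∷ τ)) b<a btw) = contradiction b<a (ℕ.<-asym m<y)
... | false with to (T-∧ {not (straddled y ys)}) t
...   | t₁ , t₂ = admissible⇒¬Forbidden m ys t₂ (drop f)
  where
  y≤m : y ≤ m
  y≤m = ℕ.≮⇒≥ λ m<y → subst T (trans (sym (<⇒<ᵇ≡true m<y)) eq) tt
  drop : Forbidden (m ∷ y ∷ ys) → Forbidden (m ∷ ys)
  drop (forbidden (_ ∷ʳ (_ ∷ʳ τ)) b<a btw)     = forbidden (_ ∷ʳ τ) b<a btw
  drop (forbidden (_ ∷ʳ (refl ∷ τ)) b<a btw)   = forbidden (refl ∷ τ) (ℕ.<-≤-trans b<a y≤m) btw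
  drop (forbidden (refl ∷ (_ ∷ʳ τ)) b<a btw)   = forbidden (refl ∷ τ) b<a btw
  drop (forbidden (refl ∷ (refl ∷ τ)) b<a btw) = ⊥-elim (T-not t₁ (straddled-between τ btw))

¬Forbidden⇒admissible : ∀ m ys → Unique (m ∷ ys) → ¬ Forbidden (m ∷ ys) → T (admissible m ys)
¬Forbidden⇒admissible m []       _ _  = tt
¬Forbidden⇒admissible m (y ∷ ys) ((m≢y ∷ m≢) ∷ (y≢ ∷ u)) ¬f with m <ᵇ y in eq
... | true  = ¬Forbidden⇒admissible y ys (y≢ ∷ u) λ (forbidden τ b<a btw) → ¬f (forbidden (m ∷ʳ τ) b<a btw)
... | false = from T-∧ (¬T-not noStraddle , ¬Forbidden⇒admissible m ys (m≢ ∷ u) (¬f ∘ insert))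
  where
  y<m : y < m
  y<m = ℕ.≤∧≢⇒< (ℕ.≮⇒≥ λ m<y → subst T (trans (sym (<⇒<ᵇ≡true m<y)) eq) tt) (m≢y ∘ sym)
  noStraddle : ¬ T (straddled y ys)
  noStraddle t with straddled⁻ y ys t
  ... | _ , _ , τ , btw = ¬f (forbidden (refl ∷ refl ∷ τ) y<m btw)
  insert : Forbidden (m ∷ ys) → Forbidden (m ∷ y ∷ ys)
  insert (forbidden (_ ∷ʳ τ) b<a btw)   = forbidden (_ ∷ʳ _ ∷ʳ τ) b<a btw
  insert (forbidden (refl ∷ τ) b<a btw) = forbidden (refl ∷ _ ∷ʳ τ) b<a btw

avoidsT₁≡admissible : ∀ m ys → Unique (m ∷ ys) → avoidsT₁ (m ∷ ys) ≡ admissible m ys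
avoidsT₁≡admissible m ys u = T-injective
  (¬Forbidden⇒admissible m ys u ∘ avoidsT₁⇒¬Forbidden u)
  (λ t → ¬Forbidden⇒avoidsT₁ (admissible⇒¬Forbidden m ys t))

-- Enumeration of permutations

count-cong : {A : Set} {p q : A → Bool} (xs : List A) → (∀ {x} → x ∈ xs → p x ≡ q x) → count p xs ≡ count q xs
count-cong         []       p≗q = refl
count-cong {p = p} {q} (x ∷ xs) p≗q with p x | q x | p≗q (here refl)
... | true  | _ | refl = cong suc (count-cong xs (p≗q ∘ there))
... | false | _ | refl = count-cong xs (p≗q ∘ there)

count-false : {A : Set} {p : A → Bool} (xs : List A) → (∀ {x} → x ∈ xs → p x ≡ false) → count p xs ≡ 0
count-false         []       p≗f = refl
count-false {p = p} (x ∷ xs) p≗f with p x | p≗f (here refl)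
... | _ | refl = count-false xs (p≗f ∘ there)

count-++ : {A : Set} (p : A → Bool) (xs ys : List A) → count p (xs ++ ys) ≡ count p xs ℕ.+ count p ys
count-++ p []       ys = refl
count-++ p (x ∷ xs) ys with p x
... | true  = cong suc (count-++ p xs ys)
... | false = count-++ p xs ys

count-map : {A B : Set} (p : B → Bool) (f : A → B) (xs : List A) → count p (map f xs) ≡ count (p ∘ f) xs
count-map p f []       = refl
count-map p f (x ∷ xs) with p (f x)
... | true  = cong suc (count-map p f xs)
... | false = count-map p f xs

filterᵇ-filterᵇ : {A : Set} (p q : A → Bool) (xs : List A) →
  filterᵇ p (filterᵇ q xs) ≡ filterᵇ (λ x → q x ∧ p x) xs
filterᵇ-filterᵇ p q []       = refl
filterᵇ-filterᵇ p q (x ∷ xs) with q x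
... | false = filterᵇ-filterᵇ p q xs
... | true with p x
...   | true  = cong (x ∷_) (filterᵇ-filterᵇ p q xs)
...   | false = filterᵇ-filterᵇ p q xs

filterᵇ-++ : {A : Set} (p : A → Bool) (xs ys : List A) → filterᵇ p (xs ++ ys) ≡ filterᵇ p xs ++ filterᵇ p ys
filterᵇ-++ p []       ys = refl
filterᵇ-++ p (x ∷ xs) ys with p x
... | true  = cong (x ∷_) (filterᵇ-++ p xs ys)
... | false = filterᵇ-++ p xs ys

filterᵇ-map : {A B : Set} (p : B → Bool) (f : A → B) (xs : List A) →
  filterᵇ p (map f xs) ≡ map f (filterᵇ (p ∘ f) xs)
filterᵇ-map p f []       = refl
filterᵇ-map p f (x ∷ xs) with p (f x)
... | true  = cong (f x ∷_) (filterᵇ-map p f xs)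
... | false = filterᵇ-map p f xs

filterᵇ-concatMap : {A B : Set} (p : B → Bool) (f : A → List B) (xs : List A) →
  filterᵇ p (concatMap f xs) ≡ concatMap (filterᵇ p ∘ f) xs
filterᵇ-concatMap p f []       = refl
filterᵇ-concatMap p f (x ∷ xs) = trans (filterᵇ-++ p (f x) (concatMap f xs))
  (cong (filterᵇ p (f x) ++_) (filterᵇ-concatMap p f xs))

filterᵇ-none : {A : Set} (xs : List A) → filterᵇ (λ _ → false) xs ≡ []
filterᵇ-none []       = refl
filterᵇ-none (x ∷ xs) = filterᵇ-none xs

filterᵇ-all : {A : Set} {p : A → Bool} (xs : List A) → (∀ {x} → x ∈ xs → p x ≡ true) → filterᵇ p xs ≡ xs
filterᵇ-all []       p≗t = refl
filterᵇ-all {p = p} (x ∷ xs) p≗t with p x | p≗t (here refl)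
... | _ | refl = cong (x ∷_) (filterᵇ-all xs (p≗t ∘ there))

picks : List ℕ → List (ℕ × List ℕ)
picks []       = []
picks (x ∷ xs) = (x , xs) ∷ map (map₂ (x ∷_)) (picks xs)

-- The number `r` drives the recursion and is independent of `L`, as in `wordsOver`; the counts
-- below take it to be the length of `L`.
perms : ℕ → List ℕ → List (List ℕ)
perms zero    L = [ [] ]
perms (suc r) L = concatMap (λ (a , L′) → map (a ∷_) (perms r L′)) (picks L)

picks-↭ : ∀ {a L′} L → (a , L′) ∈ picks L → a ∷ L′ ↭ L
picks-↭ (x ∷ xs) (here refl) = ↭-refl
picks-↭ (x ∷ xs) (there p∈) with ∈-map⁻ (map₂ (x ∷_)) p∈
... | (a , L′) , q∈ , refl = ↭-trans (swap a x ↭-refl) (prep x (picks-↭ xs q∈))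

perms-↭ : ∀ r {L σ} → length L ≡ r → σ ∈ perms r L → σ ↭ L
perms-↭ zero    {[]} refl (here refl) = ↭-refl
perms-↭ (suc r) {L}  len  σ∈ with ∈-concat⁻′ (map (λ (a , L′) → map (a ∷_) (perms r L′)) (picks L)) σ∈
... | ws , σ∈ws , ws∈ with ∈-map⁻ _ ws∈
...   | (a , L′) , p∈ , refl with ∈-map⁻ (a ∷_) σ∈ws
...     | σ′ , σ′∈ , refl = ↭-trans (prep a (perms-↭ r len′ σ′∈)) (picks-↭ L p∈)
  where
  len′ : length L′ ≡ r
  len′ = ℕ.suc-injective (trans (↭-length (picks-↭ L p∈)) len)

wordsOver : ℕ → List ℕ → List (List ℕ)
wordsOver zero    L = [ [] ]
wordsOver (suc r) L = concatMap (λ a → map (a ∷_) (wordsOver r L)) L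

words≡wordsOver : ∀ r m → words r m ≡ wordsOver r (upTo m)
words≡wordsOver zero    m = refl
words≡wordsOver (suc r) m = cong (λ W → concatMap (λ a → map (a ∷_) W) (upTo m)) (words≡wordsOver r m)

delete : ℕ → List ℕ → List ℕ
delete a = filterᵇ (λ b → not (a == b))

-- Lets the filter `distinct` act one letter at a time: after a first letter `a` the rest is again a
-- word over an alphabet, now without `a`.
notIn-wordsOver : ∀ a r L → filterᵇ (notIn a) (wordsOver r L) ≡ wordsOver r (delete a L)
notIn-wordsOver a zero    L = refl
notIn-wordsOver a (suc r) L = trans
  (filterᵇ-concatMap (notIn a) (λ b → map (b ∷_) (wordsOver r L)) L)
  (go L)
  where
  byHead : ∀ b → filterᵇ (notIn a) (map (b ∷_) (wordsOver r L)) ≡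
    (if not (a == b) then map (b ∷_) (wordsOver r (delete a L)) else [])
  byHead b = trans (filterᵇ-map (notIn a) (b ∷_) (wordsOver r L)) (split (not (a == b)))
    where
    split : ∀ c → map (b ∷_) (filterᵇ (λ w → c ∧ notIn a w) (wordsOver r L)) ≡
      (if c then map (b ∷_) (wordsOver r (delete a L)) else [])
    split true  = cong (map (b ∷_)) (notIn-wordsOver a r L)
    split false = cong (map (b ∷_)) (filterᵇ-none (wordsOver r L))
  go : ∀ L′ → concatMap (λ b → filterᵇ (notIn a) (map (b ∷_) (wordsOver r L))) L′ ≡
    concatMap (λ b → map (b ∷_) (wordsOver r (delete a L))) (delete a L′)
  go []       = refl
  go (b ∷ L′) rewrite byHead b with not (a == b)
  ... | true  = cong (map (b ∷_) (wordsOver r (delete a L)) ++_) (go L′)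
  ... | false = go L′

==-refl : ∀ n → (n == n) ≡ true
==-refl n = to T-≡ (ℕ.≡⇒≡ᵇ n n refl)

≢⇒==-false : ∀ {m n} → m ≢ n → (m == n) ≡ false
≢⇒==-false {m} {n} m≢n with m == n in eq
... | false = refl
... | true  = ⊥-elim (m≢n (ℕ.≡ᵇ⇒≡ m n (subst T (sym eq) tt)))

picks≡delete : ∀ L → Unique L → map (λ a → a , delete a L) L ≡ picks L
picks≡delete []       _          = refl
picks≡delete (x ∷ xs) (x≢ ∷ u) rewrite ==-refl x = cong₂ _∷_
  (cong (x ,_) (filterᵇ-all xs λ y∈ → cong not (≢⇒==-false (All.lookup x≢ y∈))))
  (trans (keepHead xs xs x≢) (trans (map-∘ xs) (cong (map (map₂ (x ∷_))) (picks≡delete xs u))))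
  where
  keepHead : ∀ xs ys → All (x ≢_) ys →
    map (λ a → a , delete a (x ∷ xs)) ys ≡ map (λ a → a , x ∷ delete a xs) ys
  keepHead xs []       _          = refl
  keepHead xs (y ∷ ys) (x≢y ∷ x≢) rewrite ≢⇒==-false (x≢y ∘ sym) = cong (_ ∷_) (keepHead xs ys x≢)

distinct-wordsOver : ∀ r L → Unique L → filterᵇ distinct (wordsOver r L) ≡ perms r L
distinct-wordsOver zero    L u = refl
distinct-wordsOver (suc r) L u = begin
  filterᵇ distinct (concatMap (λ a → map (a ∷_) (wordsOver r L)) L)
    ≡⟨ filterᵇ-concatMap distinct (λ a → map (a ∷_) (wordsOver r L)) L ⟩
  concatMap (λ a → filterᵇ distinct (map (a ∷_) (wordsOver r L))) L
    ≡⟨ concatMap-cong byHead L ⟩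
  concatMap (λ a → map (a ∷_) (perms r (delete a L))) L
    ≡⟨ concatMap-map (λ (a , L′) → map (a ∷_) (perms r L′)) (λ a → a , delete a L) L ⟨
  concatMap (λ (a , L′) → map (a ∷_) (perms r L′)) (map (λ a → a , delete a L) L)
    ≡⟨ cong (concatMap (λ (a , L′) → map (a ∷_) (perms r L′))) (picks≡delete L u) ⟩
  perms (suc r) L
    ∎
  where
  delete-all : ∀ {P : ℕ → Set} a {L} → All P L → All P (delete a L)
  delete-all a []                 = []
  delete-all a (_∷_ {x} px pxs) with not (a == x)
  ... | true  = px ∷ delete-all a pxs
  ... | false = delete-all a pxs
  delete-unique : ∀ a {L} → Unique L → Unique (delete a L)
  delete-unique a []                 = []
  delete-unique a (_∷_ {x} px pxs) with not (a == x)
  ... | true  = delete-all a px ∷ delete-unique a pxs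
  ... | false = delete-unique a pxs
  byHead : ∀ a → filterᵇ distinct (map (a ∷_) (wordsOver r L)) ≡ map (a ∷_) (perms r (delete a L))
  byHead a = begin
    filterᵇ distinct (map (a ∷_) (wordsOver r L))
      ≡⟨ filterᵇ-map distinct (a ∷_) (wordsOver r L) ⟩
    map (a ∷_) (filterᵇ (λ w → notIn a w ∧ distinct w) (wordsOver r L))
      ≡⟨ cong (map (a ∷_)) (filterᵇ-filterᵇ distinct (notIn a) (wordsOver r L)) ⟨
    map (a ∷_) (filterᵇ distinct (filterᵇ (notIn a) (wordsOver r L)))
      ≡⟨ cong (λ W → map (a ∷_) (filterᵇ distinct W)) (notIn-wordsOver a r L) ⟩
    map (a ∷_) (filterᵇ distinct (wordsOver r (delete a L)))
      ≡⟨ cong (map (a ∷_)) (distinct-wordsOver r (delete a L) (delete-unique a u)) ⟩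
    map (a ∷_) (perms r (delete a L))
      ∎

-- Counting completions of a prefix

sumPicks : (ℕ → List ℕ → ℤ) → List ℕ → ℤ
sumPicks f []       = + 0
sumPicks f (x ∷ xs) = f x xs + sumPicks (λ a L → f a (x ∷ L)) xs

sumPicks-cong : ∀ {f g} xs → (∀ a L → a ∷ L ↭ xs → f a L ≡ g a L) → sumPicks f xs ≡ sumPicks g xs
sumPicks-cong []       f≗g = refl
sumPicks-cong (x ∷ xs) f≗g = cong₂ _+_ (f≗g x xs ↭-refl)
  (sumPicks-cong xs λ a L p → f≗g a (x ∷ L) (↭-trans (swap a x ↭-refl) (prep x p)))

sumPicks-zero : ∀ {f} xs → (∀ a L → a ∷ L ↭ xs → f a L ≡ + 0) → sumPicks f xs ≡ + 0
sumPicks-zero []       f≗0 = refl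
sumPicks-zero (x ∷ xs) f≗0 = cong₂ _+_ (f≗0 x xs ↭-refl)
  (sumPicks-zero xs λ a L p → f≗0 a (x ∷ L) (↭-trans (swap a x ↭-refl) (prep x p)))

sumPicks-++ : ∀ f xs ys → sumPicks f (xs ++ ys) ≡
  sumPicks (λ a L → f a (L ++ ys)) xs + sumPicks (λ a L → f a (xs ++ L)) ys
sumPicks-++ f []       ys = sym (+-identityˡ _)
sumPicks-++ f (x ∷ xs) ys = trans
  (cong (_+_ (f x (xs ++ ys))) (sumPicks-++ (λ a L → f a (x ∷ L)) xs ys))
  (sym (+-assoc (f x (xs ++ ys)) _ _))

sumPicks-shiftY : ∀ (f : ℕ → List ℕ → ℕ → ℤ) xs k →
  sumPicks (λ a L → shiftY (f a L) k) xs ≡ shiftY (λ k → sumPicks (λ a L → f a L k) xs) k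
sumPicks-shiftY f xs zero    = sumPicks-zero xs λ _ _ _ → refl
sumPicks-shiftY f xs (suc k) = refl

cnt : (List ℕ → Bool) → List (List ℕ) → ℤ
cnt p xs = + count p xs

cnt-picks : ∀ p (h : ℕ × List ℕ → List (List ℕ)) L →
  cnt p (concatMap h (picks L)) ≡ sumPicks (λ a L′ → cnt p (h (a , L′))) L
cnt-picks p h []       = refl
cnt-picks p h (x ∷ xs) = begin
  cnt p (h (x , xs) ++ concatMap h (map (map₂ (x ∷_)) (picks xs)))
    ≡⟨ cong (λ W → cnt p (h (x , xs) ++ W)) (concatMap-map h (map₂ (x ∷_)) (picks xs)) ⟩
  cnt p (h (x , xs) ++ concatMap (h ∘ map₂ (x ∷_)) (picks xs))
    ≡⟨ cong +_ (count-++ p (h (x , xs)) _) ⟩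
  + (count p (h (x , xs)) ℕ.+ count p (concatMap (h ∘ map₂ (x ∷_)) (picks xs)))
    ≡⟨ pos-+ (count p (h (x , xs))) _ ⟩
  cnt p (h (x , xs)) + cnt p (concatMap (h ∘ map₂ (x ∷_)) (picks xs))
    ≡⟨ cong (_+_ (cnt p (h (x , xs)))) (cnt-picks p (h ∘ map₂ (x ∷_)) xs) ⟩
  sumPicks (λ a L′ → cnt p (h (a , L′))) (x ∷ xs)
    ∎

cnt-perms : ∀ p r L → length L ≡ suc r →
  cnt p (perms (length L) L) ≡ sumPicks (λ a L′ → cnt (p ∘ (a ∷_)) (perms (length L′) L′)) L
cnt-perms p r L len = begin
  cnt p (perms (length L) L)
    ≡⟨ cong (λ n → cnt p (perms n L)) len ⟩
  cnt p (perms (suc r) L)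
    ≡⟨ cnt-picks p (λ (a , L′) → map (a ∷_) (perms r L′)) L ⟩
  sumPicks (λ a L′ → cnt p (map (a ∷_) (perms r L′))) L
    ≡⟨ sumPicks-cong L (λ a L′ a∷L′↭L → cong +_ (trans (count-map p (a ∷_) (perms r L′))
         (cong (λ n → count (p ∘ (a ∷_)) (perms n L′)) (ℕ.suc-injective (trans (sym len) (sym (↭-length a∷L′↭L))))))) ⟩
  sumPicks (λ a L′ → cnt (p ∘ (a ∷_)) (perms (length L′) L′)) L
    ∎

anyᵇ-false : ∀ {p : ℕ → Bool} {xs} → All (λ x → p x ≡ false) xs → anyᵇ p xs ≡ false
anyᵇ-false []                  = refl
anyᵇ-false (eq ∷ eqs) rewrite eq = anyᵇ-false eqs

straddled-below : ∀ {y ys} → All (y <_) ys → straddled y ys ≡ false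
straddled-below {y} {ys} y<ys
  rewrite anyᵇ-false {_<ᵇ y} {ys} (All.map (λ y<x → ≤⇒<ᵇ≡false (ℕ.<⇒≤ y<x)) y<ys) = refl

straddled-above : ∀ {y ys} → All (_< y) ys → straddled y ys ≡ false
straddled-above {y} {ys} ys<y
  rewrite anyᵇ-false {y <ᵇ_} {ys} (All.map (λ x<y → ≤⇒<ᵇ≡false (ℕ.<⇒≤ x<y)) ys<y) = ∧-zeroʳ _

admissible-record : ∀ {m a} σ → m < a → admissible m (a ∷ σ) ≡ admissible a σ
admissible-record σ m<a rewrite <⇒<ᵇ≡true m<a = refl

admissible-low : ∀ {m a} σ → a < m → straddled a σ ≡ false → admissible m (a ∷ σ) ≡ admissible m σ
admissible-low σ a<m eq rewrite ≤⇒<ᵇ≡false (ℕ.<⇒≤ a<m) | eq = refl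

admissible-straddled : ∀ {m a l h} σ → a < m → l ∈ σ → h ∈ σ → l < a → a < h → admissible m (a ∷ σ) ≡ false
admissible-straddled {m} {a} σ a<m l∈ h∈ l<a a<h
  rewrite ≤⇒<ᵇ≡false (ℕ.<⇒≤ a<m) | to T-≡ (straddled⁺ {a} {σ} l∈ h∈ l<a a<h) = refl

Ascending : List ℕ → Set
Ascending = AllPairs _<_

ascending-remove : ∀ xs {y ys} → Ascending (xs ++ y ∷ ys) → Ascending (xs ++ ys) × All (_< y) xs × All (y <_) ys
ascending-remove []       (y<ys ∷ asc) = asc , [] , y<ys
ascending-remove (x ∷ xs) (x< ∷ asc) with ascending-remove xs asc | All.++⁻ xs x<
... | asc′ , xs<y , y<ys | x<xs , x<y ∷ x<ys = All.++⁺ x<xs x<ys ∷ asc′ , x<y ∷ xs<y , y<ys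

ascending-cross : ∀ xs {ys y} → Ascending (xs ++ ys) → y ∈ ys → All (_< y) xs
ascending-cross []       _            _  = []
ascending-cross (x ∷ xs) (x< ∷ asc) y∈ = All.lookup x< (∈-++⁺ʳ xs y∈) ∷ ascending-cross xs asc y∈

-- By `ℓ-step`, `ℓ` is a condition on the last entry. It is constantly true for F and `lastIsMax`
-- for E, so one count serves both.
module StateCount
  (ℓ : List ℕ → Bool) (ℓ-step : ∀ a b σ → ℓ (a ∷ b ∷ σ) ≡ ℓ (b ∷ σ))
  where

  -- `m` is the running maximum and `p` the entry placed last, kept so that an ascent from it into
  -- `σ` is counted.
  valid : ℕ → ℕ → ℕ → List ℕ → Bool
  valid m p k σ = admissible m σ ∧ (ℓ (p ∷ σ) ∧ (asc (p ∷ σ) == k))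

  completions : ℕ → ℕ → List ℕ → ℕ → ℤ
  completions m p L k = cnt (valid m p k) (perms (length L) L)

  completionsVia : ℕ → ℕ → ℕ → List ℕ → ℕ → ℤ
  completionsVia m p a L k = cnt (valid m p k ∘ (a ∷_)) (perms (length L) L)

  completions-picks : ∀ m p {x} L k → x ∈ L →
    completions m p L k ≡ sumPicks (λ a L′ → completionsVia m p a L′ k) L
  completions-picks m p L@(_ ∷ _) k _ = cnt-perms (valid m p k) _ L refl

  via-step : ∀ {m m′ p a L} c k → (∀ {σ} → σ ↭ L → admissible m (a ∷ σ) ≡ admissible m′ σ) →
    (p <ᵇ a) ≡ c → completionsVia m p a L k ≡ shiftYIf c (completions m′ a L) k
  via-step {m} {m′} {p} {a} {L} false k adm p<ᵇa = cong +_ (count-cong (perms (length L) L) λ {σ} σ∈ →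
    cong₂ _∧_ (adm (perms-↭ (length L) refl σ∈))
      (cong₂ _∧_ (ℓ-step p a σ) (cong (λ b → ((if b then 1 else 0) ℕ.+ asc (a ∷ σ)) == k) p<ᵇa)))
  -- The step from `p` to `a` is an ascent, so no completion has 0 ascents.
  via-step {m} {m′} {p} {a} {L} true zero adm p<ᵇa = cong +_ (count-false (perms (length L) L) λ {σ} σ∈ →
    trans (cong (admissible m (a ∷ σ) ∧_)
      (trans (cong (λ b → ℓ (p ∷ a ∷ σ) ∧ (((if b then 1 else 0) ℕ.+ asc (a ∷ σ)) == 0)) p<ᵇa) (∧-zeroʳ _)))
      (∧-zeroʳ _))
  via-step {m} {m′} {p} {a} {L} true (suc k) adm p<ᵇa = cong +_ (count-cong (perms (length L) L) λ {σ} σ∈ →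
    cong₂ _∧_ (adm (perms-↭ (length L) refl σ∈))
      (cong₂ _∧_ (ℓ-step p a σ) (cong (λ b → ((if b then 1 else 0) ℕ.+ asc (a ∷ σ)) == suc k) p<ᵇa)))

  via-record : ∀ {m p a L} k → m < a → p < a → completionsVia m p a L k ≡ shiftY (completions a a L) k
  via-record {L = L} k m<a p<a = via-step {L = L} true k (λ {σ} _ → admissible-record σ m<a) (<⇒<ᵇ≡true p<a)

  via-least : ∀ {m p a L} c k → a < m → All (a <_) L → (p <ᵇ a) ≡ c →
    completionsVia m p a L k ≡ shiftYIf c (completions m a L) k
  via-least c k a<m a<L = via-step c k λ {σ} σ↭L →
    admissible-low σ a<m (straddled-below (All-resp-↭ (↭-sym σ↭L) a<L))

  via-greatest : ∀ {m p a L} c k → a < m → All (_< a) L → (p <ᵇ a) ≡ c →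
    completionsVia m p a L k ≡ shiftYIf c (completions m a L) k
  via-greatest c k a<m L<a = via-step c k λ {σ} σ↭L →
    admissible-low σ a<m (straddled-above (All-resp-↭ (↭-sym σ↭L) L<a))

  via-straddled : ∀ {m p a L l h} k → a < m → l ∈ L → h ∈ L → l < a → a < h → completionsVia m p a L k ≡ + 0
  via-straddled {m} {p} {a} {L} k a<m l∈ h∈ l<a a<h = cong +_ (count-false (perms (length L) L) λ {σ} σ∈ →
    let L↭σ = ↭-sym (perms-↭ (length L) refl σ∈) in
    cong (_∧ (ℓ (p ∷ a ∷ σ) ∧ (asc (p ∷ a ∷ σ) == k)))
      (admissible-straddled σ a<m (∈-resp-↭ L↭σ l∈) (∈-resp-↭ L↭σ h∈) l<a a<h))

  module _ (t : Series)
    (terminal-count : ∀ m L k → Ascending L → All (_< m) L → ℓ (m ∷ []) ≡ true →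
       completions m m L k ≡ t (length L) k)
    where

    -- A value of `Hi` that is passed over joins the end of `Lo`, which is the move from above to
    -- below in `rise`. As `Hi` ascends, `ℓ (m ∷ Hi)` is the condition on the greatest value; it is
    -- carried along until that value is the running maximum and `terminal-count` applies.
    rise-count : ∀ m Lo Hi k → Ascending (Lo ++ Hi) → ℓ (m ∷ Hi) ≡ true →
      sumPicks (λ a L → completions a a (Lo ++ L) k) Hi ≡ rise t (length Lo) (length Hi) k
    place-count : ∀ m p c Lo Hi {y} k → y ∈ Hi → Ascending (Lo ++ Hi) → ℓ (m ∷ Hi) ≡ true →
      All (_< m) Lo → All (m <_) Hi → All (p <_) Hi → All (λ a → (p <ᵇ a) ≡ c) Lo →
      completions m p (Lo ++ Hi) k ≡ place t c (length Lo) (length Hi) k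

    rise-count m Lo []       k asc ℓ≡ = refl
    rise-count m Lo (a ∷ ys) k asc ℓ≡ with ascending-remove Lo asc
    ... | asc′ , Lo<a , a<ys = begin
      completions a a (Lo ++ ys) k + sumPicks (λ b L → completions b b (Lo ++ a ∷ L) k) ys
        ≡⟨ cong₂ _+_ (first ys asc′ a<ys ℓ≡′) rest ⟩
      (constX (t (length Lo)) (length ys) k + place t false (length Lo) (length ys) k) + rise t (suc (length Lo)) (length ys) k
        ≡⟨ +-assoc (constX (t (length Lo)) (length ys) k) _ _ ⟩
      rise t (length Lo) (suc (length ys)) k
        ∎
      where
      ℓ≡′ : ℓ (a ∷ ys) ≡ true
      ℓ≡′ = trans (sym (ℓ-step m a ys)) ℓ≡
      first : ∀ ys → Ascending (Lo ++ ys) → All (a <_) ys → ℓ (a ∷ ys) ≡ true →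
        completions a a (Lo ++ ys) k ≡ constX (t (length Lo)) (length ys) k + place t false (length Lo) (length ys) k
      first []       asc′ _    ℓ≡′ = trans
        (subst (λ L → completions a a L k ≡ t (length Lo) k) (sym (++-identityʳ Lo))
          (terminal-count a Lo k (subst Ascending (++-identityʳ Lo) asc′) Lo<a ℓ≡′))
        (sym (+-identityʳ _))
      first (y ∷ ys) asc′ a<ys ℓ≡′ = trans
        (place-count a a false Lo (y ∷ ys) k (here refl) asc′ ℓ≡′ Lo<a a<ys a<ys (All.map (λ x<a → ≤⇒<ᵇ≡false (ℕ.<⇒≤ x<a)) Lo<a))
        (sym (+-identityˡ _))
      rest : sumPicks (λ b L → completions b b (Lo ++ a ∷ L) k) ys ≡ rise t (suc (length Lo)) (length ys) k
      rest = begin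
        sumPicks (λ b L → completions b b (Lo ++ a ∷ L) k) ys
          ≡⟨ (sumPicks-cong ys λ b L _ → cong (λ L → completions b b L k) (sym (++-assoc Lo [ a ] L))) ⟩
        sumPicks (λ b L → completions b b ((Lo ++ [ a ]) ++ L) k) ys
          ≡⟨ rise-count a (Lo ++ [ a ]) ys k (subst Ascending (sym (++-assoc Lo [ a ] ys)) asc) ℓ≡′ ⟩
        rise t (length (Lo ++ [ a ])) (length ys) k
          ≡⟨ cong (λ h → rise t h (length ys) k) (length-++-comm Lo [ a ]) ⟩
        rise t (suc (length Lo)) (length ys) k
          ∎

    place-count m p c Lo Hi k y∈Hi asc ℓ≡ Lo<m m<Hi p<Hi p<ᵇLo = begin
      completions m p (Lo ++ Hi) k
        ≡⟨ completions-picks m p (Lo ++ Hi) k (∈-++⁺ʳ Lo y∈Hi) ⟩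
      sumPicks (λ a L → completionsVia m p a L k) (Lo ++ Hi)
        ≡⟨ sumPicks-++ (λ a L → completionsVia m p a L k) Lo Hi ⟩
      sumPicks (λ a L → completionsVia m p a (L ++ Hi) k) Lo + sumPicks (λ a L → completionsVia m p a (Lo ++ L) k) Hi
        ≡⟨ cong (_+_ (sumPicks (λ a L → completionsVia m p a (L ++ Hi) k) Lo)) records ⟩
      sumPicks (λ a L → completionsVia m p a (L ++ Hi) k) Lo + shiftY (rise t (length Lo) (length Hi)) k
        ≡⟨ +-comm (sumPicks (λ a L → completionsVia m p a (L ++ Hi) k) Lo) _ ⟩
      shiftY (rise t (length Lo) (length Hi)) k + sumPicks (λ a L → completionsVia m p a (L ++ Hi) k) Lo
        ≡⟨ low Lo asc Lo<m p<ᵇLo ⟩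
      place t c (length Lo) (length Hi) k
        ∎
      where
      records : sumPicks (λ a L → completionsVia m p a (Lo ++ L) k) Hi ≡ shiftY (rise t (length Lo) (length Hi)) k
      records = begin
        sumPicks (λ a L → completionsVia m p a (Lo ++ L) k) Hi
          ≡⟨ (sumPicks-cong Hi λ a L a∷L↭Hi → via-record {L = Lo ++ L} k
                (All.lookup m<Hi (∈-resp-↭ a∷L↭Hi (here refl))) (All.lookup p<Hi (∈-resp-↭ a∷L↭Hi (here refl)))) ⟩
        sumPicks (λ a L → shiftY (completions a a (Lo ++ L)) k) Hi
          ≡⟨ sumPicks-shiftY (λ a L → completions a a (Lo ++ L)) Hi k ⟩
        shiftY (λ k → sumPicks (λ a L → completions a a (Lo ++ L) k) Hi) k
          ≡⟨ shiftY-cong (λ k → rise-count m Lo Hi k asc ℓ≡) k ⟩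
        shiftY (rise t (length Lo) (length Hi)) k
          ∎
      low : ∀ Lo → Ascending (Lo ++ Hi) → All (_< m) Lo → All (λ a → (p <ᵇ a) ≡ c) Lo →
        shiftY (rise t (length Lo) (length Hi)) k + sumPicks (λ a L → completionsVia m p a (L ++ Hi) k) Lo
          ≡ place t c (length Lo) (length Hi) k
      low []        _            _            _          = trans (+-identityʳ _) (sym (place-zero-≐ t c (length Hi) k))
      low (a ∷ Lo′) (a< ∷ asc) (a<m ∷ Lo′<m) (p<ᵇa ∷ _) = begin
        shiftY r k + (completionsVia m p a (Lo′ ++ Hi) k + sumPicks (λ b L → completionsVia m p b (a ∷ L ++ Hi) k) Lo′)
          ≡⟨ cong (_+_ (shiftY r k)) (cong₂ _+_ (via-least {L = Lo′ ++ Hi} c k a<m a< p<ᵇa) others) ⟩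
        shiftY r k + (shiftYIf c (completions m a (Lo′ ++ Hi)) k + + 0)
          ≡⟨ cong (_+_ (shiftY r k)) (+-identityʳ _) ⟩
        shiftY r k + shiftYIf c (completions m a (Lo′ ++ Hi)) k
          ≡⟨ cong (_+_ (shiftY r k)) (shiftYIf-cong c (λ k → place-count m a true Lo′ Hi k y∈Hi asc ℓ≡ Lo′<m m<Hi
               (All.++⁻ʳ Lo′ a<) (All.map <⇒<ᵇ≡true (All.++⁻ˡ Lo′ a<))) k) ⟩
        shiftY r k + shiftYIf c (place t true (length Lo′) (length Hi)) k
          ≡⟨ place-suc-≐ t c (length Lo′) (length Hi) k ⟨
        place t c (suc (length Lo′)) (length Hi) k
          ∎
        where
        r = rise t (suc (length Lo′)) (length Hi)
        others : sumPicks (λ b L → completionsVia m p b (a ∷ L ++ Hi) k) Lo′ ≡ + 0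
        others = sumPicks-zero Lo′ λ b L b∷L↭Lo′ →
          let b∈ = ∈-resp-↭ b∷L↭Lo′ (here refl) in
          via-straddled {L = a ∷ L ++ Hi} k (All.lookup Lo′<m b∈) (here refl) (there (∈-++⁺ʳ L y∈Hi))
            (All.lookup a< (∈-++⁺ˡ b∈)) (All.lookup (ascending-cross Lo′ asc y∈Hi) b∈)

-- The two series

asc-nil-count : ∀ k → + (count {A = List ℕ} (λ _ → 0 == k) [ [] ]) ≡ oneS 0 k
asc-nil-count zero    = refl
asc-nil-count (suc k) = refl

module All-Permutations where

  open StateCount (λ _ → true) (λ _ _ _ → refl)

  completions-below : ∀ s m p c L k → length L ≡ suc s → Ascending L → All (_< m) L → All (λ a → (p <ᵇ a) ≡ c) L →
    completions m p L k ≡ shiftYIf c (terminal (suc s)) k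
  completions-below zero m p c (a ∷ []) k len asc (a<m ∷ []) (p<ᵇa ∷ []) = begin
    completions m p (a ∷ []) k
      ≡⟨ completions-picks m p (a ∷ []) k (here refl) ⟩
    completionsVia m p a [] k + + 0
      ≡⟨ +-identityʳ _ ⟩
    completionsVia m p a [] k
      ≡⟨ via-least {L = []} c k a<m [] p<ᵇa ⟩
    shiftYIf c (completions m a []) k
      ≡⟨ shiftYIf-cong c asc-nil-count k ⟩
    shiftYIf c (oneS 0) k
      ∎
  completions-below (suc s) m p c (a ∷ L) k len asc below p<ᵇ with initLast L
  completions-below (suc s) m p c (a ∷ .[]) k () asc below p<ᵇ | []
  completions-below (suc s) m p c (a ∷ .(mid ++ [ z ])) k len (a< ∷ asc) (a<m ∷ L<m) (p<ᵇa ∷ p<ᵇL) | mid ∷ʳ′ z = begin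
    completions m p (a ∷ mid ++ [ z ]) k
      ≡⟨ completions-picks m p (a ∷ mid ++ [ z ]) k (here refl) ⟩
    completionsVia m p a (mid ++ [ z ]) k + sumPicks (λ b L → completionsVia m p b (a ∷ L) k) (mid ++ [ z ])
      ≡⟨ cong₂ _+_ (via-least {L = mid ++ [ z ]} c k a<m a< p<ᵇa) (sumPicks-++ (λ b L → completionsVia m p b (a ∷ L) k) mid [ z ]) ⟩
    shiftYIf c (completions m a (mid ++ [ z ])) k
      + (sumPicks (λ b L → completionsVia m p b (a ∷ L ++ [ z ]) k) mid + (completionsVia m p z (a ∷ mid ++ []) k + + 0))
      ≡⟨ cong (_+_ (shiftYIf c (completions m a (mid ++ [ z ])) k)) (cong₂ _+_ middle (trans (+-identityʳ _) greatest)) ⟩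
    shiftYIf c (completions m a (mid ++ [ z ])) k + (+ 0 + shiftYIf c (completions m z (a ∷ mid)) k)
      ≡⟨ cong₂ _+_ (shiftYIf-cong c afterLeast k) (trans (+-identityˡ _) (shiftYIf-cong c afterGreatest k)) ⟩
    shiftYIf c (shiftY (terminal (suc s))) k + shiftYIf c (terminal (suc s)) k
      ≡⟨ shiftYIf-+ c (shiftY (terminal (suc s))) (terminal (suc s)) k ⟨
    shiftYIf c (terminal (suc (suc s))) k
      ∎
    where
    len′ : length (mid ++ [ z ]) ≡ suc s
    len′ = ℕ.suc-injective len
    mid<z : All (_< z) mid
    mid<z = ascending-cross mid asc (here refl)
    a<z : a < z
    a<z = All.lookup a< (∈-++⁺ʳ mid (here refl))
    a∷mid<z : All (_< z) (a ∷ mid)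
    a∷mid<z = a<z ∷ mid<z
    z<m : z < m
    z<m = All.lookup L<m (∈-++⁺ʳ mid (here refl))
    middle : sumPicks (λ b L → completionsVia m p b (a ∷ L ++ [ z ]) k) mid ≡ + 0
    middle = sumPicks-zero mid λ b L b∷L↭mid →
      let b∈ = ∈-resp-↭ b∷L↭mid (here refl) in
      via-straddled {L = a ∷ L ++ [ z ]} k (All.lookup (All.++⁻ˡ mid L<m) b∈) (here refl) (there (∈-++⁺ʳ L (here refl)))
        (All.lookup a< (∈-++⁺ˡ b∈)) (All.lookup mid<z b∈)
    greatest : completionsVia m p z (a ∷ mid ++ []) k ≡ shiftYIf c (completions m z (a ∷ mid)) k
    greatest = trans (cong (λ L → completionsVia m p z (a ∷ L) k) (++-identityʳ mid))
      (via-greatest {L = a ∷ mid} c k z<m a∷mid<z (All.lookup p<ᵇL (∈-++⁺ʳ mid (here refl))))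
    afterLeast : ∀ k → completions m a (mid ++ [ z ]) k ≡ shiftY (terminal (suc s)) k
    afterLeast k = completions-below s m a true (mid ++ [ z ]) k len′ asc L<m (All.map <⇒<ᵇ≡true a<)
    ascending-init : Ascending (a ∷ mid)
    ascending-init = subst Ascending (++-identityʳ (a ∷ mid)) (proj₁ (ascending-remove (a ∷ mid) (a< ∷ asc)))
    afterGreatest : ∀ k → completions m z (a ∷ mid) k ≡ terminal (suc s) k
    afterGreatest k = completions-below s m z false (a ∷ mid) k (trans (sym (length-++-comm mid [ z ])) len′)
      ascending-init (a<m ∷ All.++⁻ˡ mid L<m) (All.map (λ x<z → ≤⇒<ᵇ≡false (ℕ.<⇒≤ x<z)) a∷mid<z)

  terminal-count : ∀ m L k → Ascending L → All (_< m) L → true ≡ true → completions m m L k ≡ terminal (length L) k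
  terminal-count m []      k _   _   _ = asc-nil-count k
  terminal-count m (x ∷ L) k asc L<m _ = completions-below (length L) m m false (x ∷ L) k refl asc L<m
    (All.map (λ x<m → ≤⇒<ᵇ≡false (ℕ.<⇒≤ x<m)) L<m)

module Last-Maximal (n : ℕ) where

  lastIsMax-step : ∀ a b σ → lastIsMax n (a ∷ b ∷ σ) ≡ lastIsMax n (b ∷ σ)
  lastIsMax-step a b σ = refl

  open StateCount (lastIsMax n) lastIsMax-step

  lastIsMax-below : ∀ p {x σ} → All (_< n ∸ 1) (x ∷ σ) → lastIsMax n (p ∷ x ∷ σ) ≡ false
  lastIsMax-below p {x} {[]}    (x<n ∷ []) = ≢⇒==-false (ℕ.<⇒≢ x<n)
  lastIsMax-below p {x} {y ∷ σ} (_ ∷ <n)   = lastIsMax-below x <n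

  -- If values remain after the maximum, the last entry is one of them and is too small. Only the
  -- empty remainder counts, which is `oneS` read as a weight: 1 at height 0 and 0 above.
  terminal-count : ∀ m L k → Ascending L → All (_< m) L → lastIsMax n (m ∷ []) ≡ true →
    completions m m L k ≡ oneS (length L) k
  terminal-count m []      k _ _ eq = trans
    (cong (λ b → + count {A = List ℕ} (λ _ → b ∧ (0 == k)) [ [] ]) eq) (asc-nil-count k)
  terminal-count m (x ∷ L) k _ L<m eq = cong +_ (count-false (perms (length (x ∷ L)) (x ∷ L)) λ {σ} σ∈ →
    trans (cong (λ b → admissible m σ ∧ (b ∧ (asc (m ∷ σ) == k))) (notLast σ (perms-↭ _ refl σ∈)))
          (∧-zeroʳ _))
    where
    m≡ : m ≡ n ∸ 1
    m≡ = ℕ.≡ᵇ⇒≡ m (n ∸ 1) (subst T (sym eq) tt)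
    notLast : ∀ σ → σ ↭ x ∷ L → lastIsMax n (m ∷ σ) ≡ false
    notLast []      σ↭ with ↭-length σ↭
    ... | ()
    notLast (y ∷ σ) σ↭ = lastIsMax-below m (All-resp-↭ (↭-sym σ↭) (subst (λ m → All (_< m) (x ∷ L)) m≡ L<m))

  lastIsMax-∷ʳ : ∀ xs x → lastIsMax n (xs ++ [ x ]) ≡ (x == (n ∸ 1))
  lastIsMax-∷ʳ []           x = refl
  lastIsMax-∷ʳ (y ∷ [])     x = refl
  lastIsMax-∷ʳ (y ∷ z ∷ xs) x = lastIsMax-∷ʳ (z ∷ xs) x

-- Transfer to `SnT₁`

upTo-ascending : ∀ n → Ascending (upTo n)
upTo-ascending n = AllPairs.applyUpTo⁺₁ id n λ i<j _ → i<j

upTo-unique : ∀ n → Unique (upTo n)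
upTo-unique n = AllPairs.map ℕ.<⇒≢ (upTo-ascending n)

Sn≡perms : ∀ n → Sn n ≡ perms n (upTo n)
Sn≡perms n = trans (cong (filterᵇ distinct) (words≡wordsOver n n)) (distinct-wordsOver n (upTo n) (upTo-unique n))

module _ (ℓ : List ℕ → Bool) (ℓ-step : ∀ a b σ → ℓ (a ∷ b ∷ σ) ≡ ℓ (b ∷ σ)) (t : Series) where

  open StateCount ℓ ℓ-step

  SnT₁-count :
    (∀ m L k → Ascending L → All (_< m) L → ℓ (m ∷ []) ≡ true → completions m m L k ≡ t (length L) k) →
    ∀ n k → ℓ (0 ∷ upTo (suc n)) ≡ true →
    + count (λ σ → ℓ σ ∧ (asc σ == k)) (SnT₁ (suc n)) ≡ rise t 0 (suc n) k
  SnT₁-count terminal-count n k ℓ≡ = begin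
    + count (λ σ → ℓ σ ∧ (asc σ == k)) (filterᵇ avoidsT₁ (Sn (suc n)))
      ≡⟨ cong +_ (cong length (filterᵇ-filterᵇ (λ σ → ℓ σ ∧ (asc σ == k)) avoidsT₁ (Sn (suc n)))) ⟩
    cnt good (Sn (suc n))
      ≡⟨ cong (cnt good) (Sn≡perms (suc n)) ⟩
    cnt good (perms (suc n) (upTo (suc n)))
      ≡⟨ cong (λ r → cnt good (perms r (upTo (suc n)))) (length-upTo (suc n)) ⟨
    cnt good (perms (length (upTo (suc n))) (upTo (suc n)))
      ≡⟨ cnt-perms good n (upTo (suc n)) (length-upTo (suc n)) ⟩
    sumPicks (λ a L → cnt (good ∘ (a ∷_)) (perms (length L) L)) (upTo (suc n))
      ≡⟨ (sumPicks-cong (upTo (suc n)) λ a L a∷L↭ → cong +_ (count-cong (perms (length L) L) λ {σ} σ∈ →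
           cong (_∧ (ℓ (a ∷ σ) ∧ (asc (a ∷ σ) == k)))
             (avoidsT₁≡admissible a σ (unique (↭-trans (prep a (perms-↭ (length L) refl σ∈)) a∷L↭))))) ⟩
    sumPicks (λ a L → completions a a L k) (upTo (suc n))
      -- At the start every value is a new maximum with nothing yet passed over, so `Lo` is empty.
      -- The 0 fills the place of a preceding entry in `ℓ (m ∷ Hi)`.
      ≡⟨ rise-count t terminal-count 0 [] (upTo (suc n)) k (upTo-ascending (suc n)) ℓ≡ ⟩
    rise t 0 (length (upTo (suc n))) k
      ≡⟨ cong (λ r → rise t 0 r k) (length-upTo (suc n)) ⟩
    rise t 0 (suc n) k
      ∎
    where
    good : List ℕ → Bool
    good σ = avoidsT₁ σ ∧ (ℓ σ ∧ (asc σ == k))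
    unique : ∀ {σ} → σ ↭ upTo (suc n) → Unique σ
    unique σ↭ = ↭ₛ.Unique-resp-↭ (setoid ℕ) (↭⇒↭ₛ (↭-sym σ↭)) (upTo-unique (suc n))

F≐rise : F ≐ rise terminal 0
F≐rise zero    k = refl
F≐rise (suc n) k = SnT₁-count (λ _ → true) (λ _ _ _ → refl) terminal All-Permutations.terminal-count n k refl

E≐rise : E ≐ rise oneS 0
E≐rise zero    k = refl
E≐rise (suc n) k = SnT₁-count (lastIsMax (suc n)) (Last-Maximal.lastIsMax-step (suc n)) oneS
  (Last-Maximal.terminal-count (suc n)) n k
  -- `upTo (suc n)` ends with `n`, the greatest of the 0-based values.
  (trans (cong (λ L → lastIsMax (suc n) (0 ∷ L)) (sym (upTo-∷ʳ n)))
    (trans (Last-Maximal.lastIsMax-∷ʳ (suc n) (0 ∷ upTo n) n) (==-refl n)))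

F-equation : F ≐ E ⊕ (E ⊛ ((F ⊕ mulY F) ⊖ mulY E))
F-equation n k = begin
  F n k
    ≡⟨ F≐rise n k ⟩
  rise terminal 0 n k
    ≡⟨ rise-equation terminal (λ _ → refl) terminal-suc n k ⟩
  rise oneS 0 n k + (rise oneS 0 ⊛ ((rise terminal 0 ⊕ mulY (rise terminal 0)) ⊖ mulY (rise oneS 0))) n k
    ≡⟨ cong₂ _+_ (E≐rise n k) (⊛-cong {g = (F ⊕ mulY F) ⊖ mulY E} E≐rise inner n k) ⟨
  E n k + (E ⊛ ((F ⊕ mulY F) ⊖ mulY E)) n k
    ∎
  where
  inner : (F ⊕ mulY F) ⊖ mulY E ≐ (rise terminal 0 ⊕ mulY (rise terminal 0)) ⊖ mulY (rise oneS 0)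
  inner n k = cong₂ _-_ (cong₂ _+_ (F≐rise n k) (shiftY-cong (F≐rise n) k)) (shiftY-cong (E≐rise n) k)

-- `E` has no terms of x-degree 0, so 1 - E - y E has constant term 1 and is invertible; the cleared
-- identity determines F as the quotient.
theorem15 : ∀ (n k : ℕ) →
    (F ⊛ ((oneS ⊖ E) ⊖ (yS ⊛ E))) n k ≡ (E ⊛ (oneS ⊖ (yS ⊛ E))) n k
theorem15 = cleared-equation {F} {E} F-equation
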